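{- An upper dominating set (a minimal dominating set of maximum cardinality) of a $2K_2$-free graph can be computed in polynomial time.
   Context: All graphs are finite, simple and undirected. $2K_2$-free means no induced subgraph isomorphic to the disjoint union of two edges. A dominating set is a vertex set $D$ such that every vertex outside $D$ has a neighbour in $D$; it is minimal if no proper subset is dominating. -}

module Defs where

open import Data.Bool.Base using (Bool; true; false; if_then_else_)
open import Data.Fin.Base using (Fin; toℕ; fromℕ<; remQuot)
open import Data.Fin.Patterns using (0F; 1F; 2F; 3F)
open import Data.Fin.Subset using (Subset; _∈_; _∉_; _⊂_; ∣_∣)
open import Data.Nat.Base using (ℕ; zero; suc; _+_; _*_; _∸_; _^_; _≤_; _≡ᵇ_; _<ᵇ_)
open import Data.Nat.Properties using (_<?_)
open import Data.Product.Base using (∃-syntax; _×_; _,_; uncurry)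
open import Data.Vec.Base using (tabulate)
open import Function.Definitions using (Injective)
open import Relation.Binary.PropositionalEquality using (_≡_; _≢_; refl)
open import Relation.Nullary.Decidable using (yes; no)
open import Relation.Nullary.Negation using (¬_; contradiction)

record Graph (n : ℕ) : Set where
  field
    adj        : Fin n → Fin n → Bool
    adj-sym    : ∀ u v → adj u v ≡ adj v u
    adj-irrefl : ∀ v → adj v v ≡ false

  Adj : Fin n → Fin n → Set
  Adj u v = adj u v ≡ true

open Graph public

-- G has an induced subgraph isomorphic to H: the map f is an isomorphism from
-- H onto the subgraph of G induced by the image of f.
HasInduced : ∀ {m n} → Graph m → Graph n → Set
HasInduced {m} {n} H G =
  ∃[ f ] Injective {A = Fin m} {B = Fin n} _≡_ _≡_ f ×
         (∀ i j → adj G (f i) (f j) ≡ adj H i j)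

-- Vertices 0, 1, 2, 3 with edges 01 and 23.
2K₂ : Graph 4
2K₂ = record { adj = a ; adj-sym = s ; adj-irrefl = r }
  where
  a : Fin 4 → Fin 4 → Bool
  a 0F 1F = true
  a 1F 0F = true
  a 2F 3F = true
  a 3F 2F = true
  a _  _  = false

  s : ∀ u v → a u v ≡ a v u
  s 0F 0F = refl
  s 0F 1F = refl
  s 0F 2F = refl
  s 0F 3F = refl
  s 1F 0F = refl
  s 1F 1F = refl
  s 1F 2F = refl
  s 1F 3F = refl
  s 2F 0F = refl
  s 2F 1F = refl
  s 2F 2F = refl
  s 2F 3F = refl
  s 3F 0F = refl
  s 3F 1F = refl
  s 3F 2F = refl
  s 3F 3F = refl

  r : ∀ v → a v v ≡ false
  r 0F = refl
  r 1F = refl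
  r 2F = refl
  r 3F = refl

2K₂-Free : ∀ {n} → Graph n → Set
2K₂-Free G = ¬ HasInduced 2K₂ G

Dominating : ∀ {n} → Graph n → Subset n → Set
Dominating G D = ∀ v → v ∉ D → ∃[ u ] u ∈ D × Adj G v u

MinimalDominating : ∀ {n} → Graph n → Subset n → Set
MinimalDominating G D =
  Dominating G D × (∀ D′ → D′ ⊂ D → ¬ Dominating G D′)

UpperDominating : ∀ {n} → Graph n → Subset n → Set
UpperDominating G D =
  MinimalDominating G D × (∀ D′ → MinimalDominating G D′ → ∣ D′ ∣ ≤ ∣ D ∣)

-- The machine model: structured programs for a random access machine with
-- addition, truncated subtraction and indirect addressing, at unit cost.
-- A program mentions finitely many registers; the memory is unbounded.
-- There is no multiplication, so after t steps on a graph with n vertices every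
-- number has O(t + log n) bits; hence polynomial time here coincides with
-- polynomial time on Turing machines.

data Exp : Set where
  const     : ℕ → Exp
  reg       : ℕ → Exp
  load      : Exp → Exp
  _⊕_ _⊖_   : Exp → Exp → Exp

infixl 6 _⊕_ _⊖_

data Cmd : Set where
  skip      : Cmd
  _≔_       : ℕ → Exp → Cmd
  store     : (address value : Exp) → Cmd
  _⨾_       : Cmd → Cmd → Cmd
  ifnz      : Exp → Cmd → Cmd → Cmd
  whilenz   : Exp → Cmd → Cmd

infix  5 _≔_
infixr 4 _⨾_

record State : Set where
  constructor ⟪_,_⟫
  field
    regs mem : ℕ → ℕ

open State public

_[_↦_] : (ℕ → ℕ) → ℕ → ℕ → (ℕ → ℕ)
(f [ k ↦ v ]) i = if i ≡ᵇ k then v else f i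

eval : Exp → State → ℕ
eval (const c) σ = c
eval (reg x)   σ = regs σ x
eval (load e)  σ = mem σ (eval e σ)
eval (d ⊕ e)   σ = eval d σ + eval e σ
eval (d ⊖ e)   σ = eval d σ ∸ eval e σ

-- The time taken to evaluate an expression: one step per operation.
steps : Exp → ℕ
steps (const c) = 1
steps (reg x)   = 1
steps (load e)  = suc (steps e)
steps (d ⊕ e)   = suc (steps d + steps e)
steps (d ⊖ e)   = suc (steps d + steps e)

-- ⟨ c , σ ⟩⇓⟨ σ′ , t ⟩ : started in σ, the program c halts in σ′ after t steps.
data ⟨_,_⟩⇓⟨_,_⟩ : Cmd → State → State → ℕ → Set where
  ⇓skip   : ∀ {σ} → ⟨ skip , σ ⟩⇓⟨ σ , 1 ⟩
  ⇓assign : ∀ {x e σ} →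
            ⟨ x ≔ e , σ ⟩⇓⟨ ⟪ regs σ [ x ↦ eval e σ ] , mem σ ⟫ , suc (steps e) ⟩
  ⇓store  : ∀ {d e σ} →
            ⟨ store d e , σ ⟩⇓⟨ ⟪ regs σ , mem σ [ eval d σ ↦ eval e σ ] ⟫
                              , suc (steps d + steps e) ⟩
  ⇓seq    : ∀ {c d ρ σ τ s t} →
            ⟨ c , ρ ⟩⇓⟨ σ , s ⟩ → ⟨ d , σ ⟩⇓⟨ τ , t ⟩ →
            ⟨ c ⨾ d , ρ ⟩⇓⟨ τ , s + t ⟩
  ⇓then   : ∀ {e c d σ τ t} → eval e σ ≢ 0 → ⟨ c , σ ⟩⇓⟨ τ , t ⟩ →
            ⟨ ifnz e c d , σ ⟩⇓⟨ τ , suc (steps e + t) ⟩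
  ⇓else   : ∀ {e c d σ τ t} → eval e σ ≡ 0 → ⟨ d , σ ⟩⇓⟨ τ , t ⟩ →
            ⟨ ifnz e c d , σ ⟩⇓⟨ τ , suc (steps e + t) ⟩
  ⇓done   : ∀ {e c σ} → eval e σ ≡ 0 →
            ⟨ whilenz e c , σ ⟩⇓⟨ σ , suc (steps e) ⟩
  ⇓loop   : ∀ {e c ρ σ τ s t} → eval e ρ ≢ 0 →
            ⟨ c , ρ ⟩⇓⟨ σ , s ⟩ → ⟨ whilenz e c , σ ⟩⇓⟨ τ , t ⟩ →
            ⟨ whilenz e c , ρ ⟩⇓⟨ τ , suc (steps e + (s + t)) ⟩

-- The machine is deterministic, so the existence of a halting run below
-- speaks about the run of the program.
⇓-deterministic : ∀ {c ρ σ τ s t} → ⟨ c , ρ ⟩⇓⟨ σ , s ⟩ → ⟨ c , ρ ⟩⇓⟨ τ , t ⟩ →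
                  σ ≡ τ × s ≡ t
⇓-deterministic ⇓skip   ⇓skip   = refl , refl
⇓-deterministic ⇓assign ⇓assign = refl , refl
⇓-deterministic ⇓store  ⇓store  = refl , refl
⇓-deterministic (⇓seq p q) (⇓seq p′ q′)
  with refl , refl ← ⇓-deterministic p p′
  with refl , refl ← ⇓-deterministic q q′ = refl , refl
⇓-deterministic (⇓then _ p) (⇓then _ p′)
  with refl , refl ← ⇓-deterministic p p′ = refl , refl
⇓-deterministic (⇓then nz _) (⇓else z _) = contradiction z nz
⇓-deterministic (⇓else z _) (⇓then nz _) = contradiction z nz
⇓-deterministic (⇓else _ p) (⇓else _ p′)
  with refl , refl ← ⇓-deterministic p p′ = refl , refl
⇓-deterministic (⇓done _) (⇓done _) = refl , refl
⇓-deterministic (⇓done z) (⇓loop nz _ _) = contradiction z nz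
⇓-deterministic (⇓loop nz _ _) (⇓done z) = contradiction z nz
⇓-deterministic (⇓loop _ p q) (⇓loop _ p′ q′)
  with refl , refl ← ⇓-deterministic p p′
  with refl , refl ← ⇓-deterministic q q′ = refl , refl

bit : Bool → ℕ
bit b = if b then 1 else 0

inputRegs : ℕ → ℕ → ℕ
inputRegs n zero    = n
inputRegs n (suc _) = 0

inputMem : ∀ {n} → Graph n → ℕ → ℕ
inputMem {n} G a with a <? n * n
... | yes a<n*n = bit (uncurry (adj G) (remQuot n (fromℕ< a<n*n)))
... | no  _     = 0

-- Register 0 holds n and memory cell n * i + j holds the (i , j) entry of the
-- adjacency matrix; all other registers and cells hold 0.
input : ∀ {n} → Graph n → State
input {n} G = ⟪ inputRegs n , inputMem G ⟫

-- The vertices v for which memory cell v is nonzero.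
output : ∀ n → State → Subset n
output n σ = tabulate λ v → 0 <ᵇ mem σ (toℕ v)

-- A vertex set satisfying R can be computed, for the graphs satisfying P, in
-- time polynomial in the number of vertices (equivalently, in the size n * n
-- of the input).
ComputableInPolynomialTime : (P : ∀ {n} → Graph n → Set)
                             (R : ∀ {n} → Graph n → Subset n → Set) → Set
ComputableInPolynomialTime P R =
  ∃[ c ] ∃[ a ] ∃[ k ] ∀ {n} (G : Graph n) → P G →
    ∃[ σ ] ∃[ t ] ⟨ c , input G ⟩⇓⟨ σ , t ⟩ × t ≤ a * n ^ k + a ×
                  R G (output n σ)

{-# OPTIONS --safe #-}

-- Let D be a minimal dominating set of a 2K₂-free graph G and let J be the set
-- of non-isolated vertices of G[D]; every x in J has a private neighbour p(x)
-- outside D.  For distinct x, y in J, 2K₂-freeness forces xy or p(x)p(y) to be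
-- an edge, and for disjoint pairs xy and zw it forbids that both xy and p(z)p(w)
-- are edges.  If |J| ≥ 4, then J is a clique and p(J) is independent, so that
-- (D ∖ J) ∪ p(J) is an independent set of size |D|.  If 0 < |J| ≤ 3, then J
-- contains an edge xy, and V ∖ N[x , y] is an independent set, so that
-- D = J ∪ (V ∖ N[J]).  Finally a maximal independent set S ≠ V is determined by
-- an edge us, where u ∉ S is chosen with N(u) ∩ S minimal and s ∈ N(u) ∩ S: it
-- consists of the vertices with no neighbour in {s} ∪ (V ∖ N[u , s]).  Hence some
-- upper dominating set is among O(n³) explicit candidates.
--
-- Membership in the best candidate is a formula of first-order logic with
-- cardinality comparison.  Such a formula, with k nested quantifiers, is
-- evaluated by k nested loops over the vertices.
module Submission where

open import Defs
open import Data.Bool.Base using (Bool; true; false; if_then_else_)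
import Data.Bool.Properties as Bool
open import Data.Empty using () renaming (⊥ to Empty)
open import Data.Fin.Base using (Fin; zero; suc; toℕ; fromℕ<; combine; remQuot)
open import Data.Fin.Patterns using (0F; 1F; 2F; 3F)
open import Data.Fin.Properties using (toℕ-fromℕ<; fromℕ<-toℕ; fromℕ<-cong; toℕ<n;
  toℕ-combine; remQuot-combine; toℕ-injective; _≟_; any?; all?; ¬∀⟶∃¬; suc-injective)
open import Data.Fin.Subset using (Subset; inside; outside; _∈_; _∉_; _⊆_; ∣_∣; _∩_;
  _∪_; _-_; ⁅_⁆; ∁; ⊥)
open import Data.Fin.Subset.Properties using (_∈?_; _⊂?_; ∣p∣≤n; p⊂q⇒∣p∣<∣q∣;
  p⊂q⇒∁p⊃∁q; p⊆p∪q; q⊆p∪q; x∈p∪q⁻; x∈p∩q⁺; x∈p∩q⁻; x∈⁅x⁆; x∈⁅y⁆⇒x≡y; x∈p∧x≢y⇒x∈p-y;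
  x∈p⇒p-x⊂p; ∉⊥; ⊆-antisym)
open import Data.List.Base using (List; []; _∷_; length)
open import Data.List.Relation.Unary.All as All using (All; []; _∷_)
open import Data.List.Relation.Unary.AllPairs using (AllPairs; []; _∷_)
open import Data.Nat.Base using (ℕ; zero; suc; 2+; _+_; _*_; _∸_; _^_; _≤_; _<_;
  _≡ᵇ_; _<ᵇ_; z≤n; s≤s; z<s; >-nonZero)
open import Data.Nat.Properties using (module ≤-Reasoning; *-assoc; *-distribʳ-+;
  *-identityʳ; *-monoʳ-≤; *-suc; *-zeroʳ; +-assoc; +-cancelˡ-≡; +-comm; +-identityʳ;
  +-mono-≤; +-monoʳ-≤; +-monoˡ-≤; +-suc; 0∸n≡0; <-cmp; <-irrefl; <-trans; <-≤-trans;
  <ᵇ⇒<; <⇒<ᵇ; <⇒≢; <⇒≤; ^-monoʳ-≤; ^-monoˡ-≤; _<?_; _≤?_; m+n∸m≡n; m<m+n; m<n+m;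
  m<n⇒0<n∸m; m∸n≢0⇒n<m; m∸n≤m; m≤m*n; m≤m+n; m≤n+m; n<1+n; n∸n≡0; n≤1+n; ∸-monoʳ-<;
  ≡ᵇ⇒≡; ≡⇒≡ᵇ; ≤-<-trans; ≤-antisym; ≤-pred; ≤-refl; ≤-reflexive; ≤-trans; ≤∧≢⇒<; ≮⇒≥)
open import Data.Nat.Solver using (module +-*-Solver)
open import Data.Product.Base using (∃-syntax; _×_; _,_; proj₁; proj₂; uncurry)
open import Data.Sum.Base using (_⊎_; inj₁; inj₂; [_,_])
open import Data.Sum.Function.Propositional using (_⊎-⇔_)
open import Data.Vec.Base using (Vec; []; _∷_; lookup; tabulate; here; there)
open import Data.Vec.Properties using (lookup∘tabulate; []=⇒lookup; lookup⇒[]=)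
open import Function.Base using (_∘_; id)
open import Function.Bundles using (_⇔_; mk⇔; Equivalence)
open import Function.Construct.Composition using (_⇔-∘_)
open import Function.Related.TypeIsomorphisms using (¬-cong-⇔)
open import Relation.Binary.Definitions using (tri<; tri≈; tri>)
open import Relation.Binary.PropositionalEquality using (_≡_; _≢_; refl; sym; trans;
  cong; cong₂; subst; subst₂)
open import Relation.Nullary.Decidable as Dec using (Dec; yes; no; does; ¬?; _×-dec_;
  _→-dec_; _⊎-dec_; decidable-stable; dec-true)
open import Relation.Nullary.Negation using (¬_; contradiction)

open +-*-Solver using (_:+_; _:*_; _:=_; con) renaming (solve to solve-ℕ)
open Equivalence using (to; from)

-- The compiler

-- The second argument cuts the sum off after `m` terms; these partial sums are the invariant of a
-- summation loop.
sumTo : ∀ {n} → (Fin n → ℕ) → ℕ → ℕ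
sumTo {zero}  f m       = 0
sumTo {suc n} f zero    = 0
sumTo {suc n} f (suc m) = f zero + sumTo (λ v → f (suc v)) m

sumTo-zero : ∀ {n} (f : Fin n → ℕ) → sumTo f 0 ≡ 0
sumTo-zero {zero}  f = refl
sumTo-zero {suc n} f = refl

sumTo-suc : ∀ {n} (f : Fin n → ℕ) v → sumTo f (suc (toℕ v)) ≡ sumTo f (toℕ v) + f v
sumTo-suc {suc n} f zero =
  trans (cong (f zero +_) (sumTo-zero (λ v → f (suc v)))) (+-identityʳ (f zero))
sumTo-suc {suc n} f (suc v) =
  trans (cong (f zero +_) (sumTo-suc (λ w → f (suc w)) v))
        (sym (+-assoc (f zero) _ (f (suc v))))

infixl 6 _⊞_ _⊟_

-- An intermediate language between formulas and programs. Its only loop is `∑`, which ranges over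
-- the vertices, so every term has polynomial running time.
data Term (k : ℕ) : Set where
  num     : ℕ → Term k
  var     : Fin k → Term k
  edge    : Fin k → Fin k → Term k
  _⊞_ _⊟_ : Term k → Term k → Term k
  ∑       : Term (suc k) → Term k

value : ∀ {n k} → Graph n → Term k → Vec (Fin n) k → ℕ
value G (num c)    ρ = c
value G (var i)    ρ = toℕ (lookup ρ i)
value G (edge i j) ρ = bit (adj G (lookup ρ i) (lookup ρ j))
value G (d ⊞ e)    ρ = value G d ρ + value G e ρ
value G (d ⊟ e)    ρ = value G d ρ ∸ value G e ρ
value {n} G (∑ e)  ρ = sumTo (λ v → value G e (v ∷ ρ)) n

-- The vertex v is kept in register p and the offset n * v of its row of the
-- adjacency matrix in register p + 1, as the machine cannot multiply.
for : ℕ → Cmd → Cmd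
for p c =
  p ≔ const 0 ⨾
  suc p ≔ const 0 ⨾
  whilenz (reg 0 ⊖ reg p)
    (c ⨾ p ≔ reg p ⊕ const 1 ⨾ suc p ≔ reg (suc p) ⊕ reg 0)

-- Each loop test takes 4 steps, and the two increments after the body take 8 together.
loopTime : ℕ → ℕ → ℕ
loopTime zero    b = 4
loopTime (suc m) b = 4 + ((b + 8) + loopTime m b)

forTime : ℕ → ℕ → ℕ
forTime m b = 4 + loopTime m b

-- Variables live in the registers listed in `ℓ`, the result goes to register `r`, and the registers
-- above `r` are scratch space. A sum keeps its total in `r`, the loop variable and its row offset
-- in the next two registers, and the current summand in `3 + r`.
compile : ∀ {k} → Vec ℕ k → ℕ → Term k → Cmd
compile ℓ r (num c)    = r ≔ const c
compile ℓ r (var i)    = r ≔ reg (lookup ℓ i)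
compile ℓ r (edge i j) = r ≔ load (reg (suc (lookup ℓ i)) ⊕ reg (lookup ℓ j))
compile ℓ r (d ⊞ e)    = compile ℓ r d ⨾ compile ℓ (suc r) e ⨾ r ≔ reg r ⊕ reg (suc r)
compile ℓ r (d ⊟ e)    = compile ℓ r d ⨾ compile ℓ (suc r) e ⨾ r ≔ reg r ⊖ reg (suc r)
compile ℓ r (∑ e)      =
  r ≔ const 0 ⨾
  for (suc r) (compile (suc r ∷ ℓ) (3 + r) e ⨾ r ≔ reg r ⊕ reg (3 + r))

time : ∀ {k} → Term k → ℕ → ℕ
time (num c)    n = 2
time (var i)    n = 2
time (edge i j) n = 5
time (d ⊞ e)    n = time d n + (time e n + 4)
time (d ⊟ e)    n = time d n + (time e n + 4)
time (∑ e)      n = 2 + forTime n (time e n + 4)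

-- Correctness and exact running time of compiled code

Runs : Cmd → State → ℕ → (State → Set) → Set
Runs c σ t Q = ∃[ τ ] ⟨ c , σ ⟩⇓⟨ τ , t ⟩ × Q τ

update-same : ∀ k {v w : ℕ} → (if k ≡ᵇ k then v else w) ≡ v
update-same k with k ≡ᵇ k | ≡⇒≡ᵇ k k refl
... | true | _ = refl

update-other : ∀ i k {v w : ℕ} → i ≢ k → (if i ≡ᵇ k then v else w) ≡ w
update-other i k i≢k with i ≡ᵇ k | ≡ᵇ⇒≡ i k
... | true  | eq = contradiction (eq _) i≢k
... | false | _  = refl

Counter : ℕ → ℕ → ℕ → State → Set
Counter n p v σ = regs σ 0 ≡ n × regs σ p ≡ v × regs σ (suc p) ≡ n * v

-- Initialising and advancing a loop overwrites the registers `p` and `suc p`, so a loop invariant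
-- must survive any change to them.
record Stable (p : ℕ) (P : State → Set) : Set where
  constructor stable
  field
    unaffected : ∀ σ y z → P σ → P ⟪ (regs σ [ p ↦ y ]) [ suc p ↦ z ] , mem σ ⟫

set-counter : ∀ {n} p v → 0 < p → ∀ σ {y z} → regs σ 0 ≡ n → y ≡ v → z ≡ n * v →
              Counter n p v ⟪ (regs σ [ p ↦ y ]) [ suc p ↦ z ] , mem σ ⟫
set-counter p v 0<p σ n≡ y≡ z≡ =
  trans (update-other 0 p (<⇒≢ 0<p)) n≡ ,
  trans (update-other p (suc p) (<⇒≢ (n<1+n p))) (trans (update-same p) y≡) ,
  trans (update-same (suc p)) z≡

module _ {n p b c} (P : ℕ → State → Set) (0<p : 0 < p)
         (P-stable : ∀ v → Stable p (P v))
         (body : ∀ (v : Fin n) σ → Counter n p (toℕ v) σ → P (toℕ v) σ →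
                 Runs c σ b (λ τ → Counter n p (toℕ v) τ × P (suc (toℕ v)) τ)) where

  private
    -- The machine counts in natural numbers, whereas `body` expects a vertex; the bound on `v`
    -- converts one into the other.
    body′ : ∀ {v} → v < n → ∀ σ → Counter n p v σ → P v σ →
            Runs c σ b (λ τ → Counter n p v τ × P (suc v) τ)
    body′ v<n with fromℕ< v<n | toℕ-fromℕ< v<n
    ... | v | refl = body v

    next : State → State
    next σ = let f = regs σ [ p ↦ regs σ p + 1 ] in
      ⟪ f [ suc p ↦ f (suc p) + f 0 ] , mem σ ⟫

    next-counter : ∀ v σ → Counter n p v σ → Counter n p (suc v) (next σ)
    next-counter v σ (n≡ , v≡ , w≡) = set-counter p (suc v) 0<p σ n≡
      (trans (cong (_+ 1) v≡) (+-comm v 1))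
      (trans (cong₂ _+_ (trans (update-other (suc p) p (λ eq → <⇒≢ (n<1+n p) (sym eq))) w≡)
                        (trans (update-other 0 p (<⇒≢ 0<p)) n≡))
             (trans (+-comm (n * v) n) (sym (*-suc n v))))

  -- Induction on the number `m` of rounds that remain.
  loop-⇓ : ∀ m v → v + m ≡ n → ∀ σ → Counter n p v σ → P v σ →
           Runs (whilenz (reg 0 ⊖ reg p)
                  (c ⨾ p ≔ reg p ⊕ const 1 ⨾ suc p ≔ reg (suc p) ⊕ reg 0))
                σ (loopTime m b) (λ τ → Counter n p n τ × P n τ)
  loop-⇓ zero v v≡n σ C Pv with trans (sym (+-identityʳ v)) v≡n
  loop-⇓ zero v v≡n σ C@(n≡ , v≡ , _) Pv | refl =
    σ , ⇓done (trans (cong₂ _∸_ n≡ v≡) (n∸n≡0 v)) , C , Pv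
  loop-⇓ (suc m) v v+m≡n σ C@(n≡ , v≡ , _) Pv =
    let σ₁ , run , C₁ , P₁ = body′ (subst (v <_) v+m≡n (m<m+n v z<s)) σ C Pv
        τ , rest , Q = loop-⇓ m (suc v) (trans (sym (+-suc v m)) v+m≡n) (next σ₁) (next-counter v σ₁ C₁)
                         (Stable.unaffected (P-stable (suc v)) σ₁ _ _ P₁)
    in τ , ⇓loop nonzero (⇓seq run (⇓seq ⇓assign ⇓assign)) rest , Q
    where
    nonzero : regs σ 0 ∸ regs σ p ≢ 0
    nonzero eq = <⇒≢ (s≤s z≤n) (sym (trans (sym (m+n∸m≡n v (suc m)))
      (trans (cong (_∸ v) v+m≡n) (trans (sym (cong₂ _∸_ n≡ v≡)) eq))))

  for-⇓ : ∀ σ → regs σ 0 ≡ n → P 0 σ →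
          Runs (for p c) σ (forTime n b) (λ τ → Counter n p n τ × P n τ)
  for-⇓ σ n≡ P₀
    with τ , run , Q ← loop-⇓ n 0 refl ⟪ (regs σ [ p ↦ 0 ]) [ suc p ↦ 0 ] , mem σ ⟫
                         (set-counter p 0 0<p σ n≡ refl (sym (*-zeroʳ n)))
                         (Stable.unaffected (P-stable 0) σ _ _ P₀)
    = τ , ⇓seq ⇓assign (⇓seq ⇓assign run) , Q

-- The discipline that makes nested evaluation work: code that writes only to registers from `r` on
-- preserves loop variables and intermediate results kept below `r`.
Frame : ℕ → State → State → Set
Frame r σ τ = (∀ {x} → x < r → regs τ x ≡ regs σ x) × mem τ ≡ mem σ

frame-refl : ∀ {r σ} → Frame r σ σ
frame-refl = (λ _ → refl) , refl

frame-trans : ∀ {r σ τ υ} → Frame r σ τ → Frame r τ υ → Frame r σ υ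
frame-trans (f , m) (g , l) = (λ x<r → trans (g x<r) (f x<r)) , trans l m

frame-≤ : ∀ {r s σ τ} → r ≤ s → Frame s σ τ → Frame r σ τ
frame-≤ r≤s (f , m) = (λ x<r → f (<-≤-trans x<r r≤s)) , m

frame-assign : ∀ {r x} σ v → r ≤ x → Frame r σ ⟪ regs σ [ x ↦ v ] , mem σ ⟫
frame-assign {x = x} σ v r≤x = (λ {y} y<r → update-other y x (<⇒≢ (<-≤-trans y<r r≤x))) , refl

HasMatrix : ∀ {n} → Graph n → State → Set
HasMatrix {n} G σ = ∀ i j → mem σ (n * toℕ i + toℕ j) ≡ bit (adj G i j)

record Env {n k} (G : Graph n) (ℓ : Vec ℕ k) (r : ℕ) (ρ : Vec (Fin n) k) (σ : State) : Set where
  field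
    positive : 0 < r
    matrix   : HasMatrix G σ
    size     : regs σ 0 ≡ n
    -- Each variable occupies two registers, the second being its row offset, hence the `suc`.
    bounded  : ∀ i → suc (lookup ℓ i) < r
    counters : ∀ i → Counter n (lookup ℓ i) (toℕ (lookup ρ i)) σ

open Env

env-frame : ∀ {n k G ℓ r ρ σ τ} → Frame r σ τ → Env {n} {k} G ℓ r ρ σ → Env G ℓ r ρ τ
env-frame (f , m) E = record
  { positive = positive E
  ; matrix   = λ i j → trans (cong (λ h → h _) m) (matrix E i j)
  ; size     = trans (f (positive E)) (size E)
  ; bounded  = bounded E
  ; counters = λ i → let n≡ , v≡ , w≡ = counters E i in
      trans (f (positive E)) n≡ ,
      trans (f (<-trans (n<1+n _) (bounded E i))) v≡ ,
      trans (f (bounded E i)) w≡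
  }

env-≤ : ∀ {n k G ℓ r s ρ σ} → r ≤ s → Env {n} {k} G ℓ r ρ σ → Env G ℓ s ρ σ
env-≤ r≤s E = record
  { positive = <-≤-trans (positive E) r≤s
  ; matrix   = matrix E
  ; size     = size E
  ; bounded  = λ i → <-≤-trans (bounded E i) r≤s
  ; counters = counters E
  }

env-∷ : ∀ {n k G ℓ r ρ σ p v} → suc p < r → Counter n p (toℕ v) σ →
        Env {n} {k} G ℓ r ρ σ → Env G (p ∷ ℓ) r (v ∷ ρ) σ
env-∷ {ρ = ρ} p<r C E = record
  { positive = positive E
  ; matrix   = matrix E
  ; size     = size E
  ; bounded  = λ { zero → p<r ; (suc i) → bounded E i }
  ; counters = λ { zero → C ; (suc i) → counters E i }
  }

Computes : ∀ {n k} → Graph n → Vec ℕ k → ℕ → Term k → Set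
Computes {n} G ℓ r e = ∀ ρ σ → Env G ℓ r ρ σ →
  Runs (compile ℓ r e) σ (time e n) (λ τ → regs τ r ≡ value G e ρ × Frame r σ τ)

-- For an abstract operation the step count is known only up to a propositional equality.
assign-⇓ : ∀ {x e σ s} → steps e ≡ s →
           ⟨ x ≔ e , σ ⟩⇓⟨ ⟪ regs σ [ x ↦ eval e σ ] , mem σ ⟫ , suc s ⟩
assign-⇓ refl = ⇓assign

-- Addition and subtraction share this argument: the second operand is evaluated from register
-- `suc r` on, so its frame condition preserves the first operand in `r`.
binary-⇓ : ∀ {n k} {G : Graph n} {ℓ : Vec ℕ k} {r} (_⊙_ : ℕ → ℕ → ℕ) (_⊚_ : Exp → Exp → Exp)
           (op : ∀ a b σ → eval (a ⊚ b) σ ≡ eval a σ ⊙ eval b σ) →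
           (∀ a b → steps (a ⊚ b) ≡ suc (steps a + steps b)) → ∀ d e →
           Computes G ℓ r d → Computes G ℓ (suc r) e → ∀ ρ σ → Env G ℓ r ρ σ →
           Runs (compile ℓ r d ⨾ compile ℓ (suc r) e ⨾ r ≔ reg r ⊚ reg (suc r)) σ
                (time d n + (time e n + 4))
                (λ τ → regs τ r ≡ value G d ρ ⊙ value G e ρ × Frame r σ τ)
binary-⇓ {G = G} {r = r} _⊙_ _⊚_ op cost d e cd ce ρ σ E
  with σ₁ , run₁ , v₁ , F₁ ← cd ρ σ E
  with σ₂ , run₂ , v₂ , F₂ ← ce ρ σ₁ (env-≤ (n≤1+n r) (env-frame F₁ E))
  = _ , ⇓seq run₁ (⇓seq run₂ (assign-⇓ (cost (reg r) (reg (suc r)))))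
  , trans (update-same r)
          (trans (op (reg r) (reg (suc r)) σ₂) (cong₂ _⊙_ (trans (proj₁ F₂ (n<1+n r)) v₁) v₂))
  , frame-trans F₁ (frame-trans (frame-≤ (n≤1+n r) F₂) (frame-assign σ₂ _ ≤-refl))

compile-⇓ : ∀ {n k} {G : Graph n} (ℓ : Vec ℕ k) r e → Computes G ℓ r e
compile-⇓ ℓ r (num c) ρ σ E = _ , ⇓assign , update-same r , frame-assign σ _ ≤-refl
compile-⇓ ℓ r (var i) ρ σ E =
  _ , ⇓assign , trans (update-same r) (proj₁ (proj₂ (counters E i))) , frame-assign σ _ ≤-refl
compile-⇓ ℓ r (edge i j) ρ σ E =
  _ , ⇓assign
  , trans (update-same r)
      (trans (cong (mem σ) (cong₂ _+_ (proj₂ (proj₂ (counters E i))) (proj₁ (proj₂ (counters E j)))))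
             (matrix E _ _))
  , frame-assign σ _ ≤-refl
compile-⇓ ℓ r (d ⊞ e) =
  binary-⇓ _+_ _⊕_ (λ _ _ _ → refl) (λ _ _ → refl) d e (compile-⇓ ℓ r d) (compile-⇓ ℓ (suc r) e)
compile-⇓ ℓ r (d ⊟ e) =
  binary-⇓ _∸_ _⊖_ (λ _ _ _ → refl) (λ _ _ → refl) d e (compile-⇓ ℓ r d) (compile-⇓ ℓ (suc r) e)
compile-⇓ {n} {G = G} ℓ r (∑ e) ρ σ E =
    let τ , run , _ , v≡ , F = for-⇓ P z<s P-stable body σ₁
         (trans (update-other 0 r (<⇒≢ (positive E))) (size E))
         (trans (update-same r) (sym (sumTo-zero f)) , frame-assign σ 0 ≤-refl)
    in τ , ⇓seq ⇓assign run , v≡ , F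
  where
  f : Fin n → ℕ
  f v = value G e (v ∷ ρ)

  σ₁ : State
  σ₁ = ⟪ regs σ [ r ↦ 0 ] , mem σ ⟫

  -- Loop invariant: the accumulator holds the partial sum over the vertices already visited.
  P : ℕ → State → Set
  P v τ = regs τ r ≡ sumTo f v × Frame r σ τ

  P-stable : ∀ v → Stable (suc r) (P v)
  P-stable v = stable λ τ y z (v≡ , F) →
    trans (update-other r (2 + r) (<⇒≢ (m<n+m r {2} z<s)))
          (trans (update-other r (suc r) (<⇒≢ (n<1+n r))) v≡) ,
    frame-trans F (frame-trans (frame-assign τ y (n≤1+n r))
                               (frame-assign ⟪ regs τ [ suc r ↦ y ] , mem τ ⟫ z (m≤n+m r 2)))

  body : ∀ (v : Fin n) τ → Counter n (suc r) (toℕ v) τ → P (toℕ v) τ →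
         Runs (compile (suc r ∷ ℓ) (3 + r) e ⨾ r ≔ reg r ⊕ reg (3 + r)) τ (time e n + 4)
              (λ υ → Counter n (suc r) (toℕ v) υ × P (suc (toℕ v)) υ)
  body v τ C (v≡ , F)
    with υ , run , u≡ , F₁ ← compile-⇓ (suc r ∷ ℓ) (3 + r) e (v ∷ ρ) τ
           (env-∷ (n<1+n _) C (env-≤ (m≤n+m r 3) (env-frame F E)))
    = ⟪ regs υ [ r ↦ _ ] , mem υ ⟫ , ⇓seq run ⇓assign
    , ( trans (update-other 0 r (<⇒≢ (positive E))) (trans (proj₁ F₁ z<s) (proj₁ C))
      , trans (update-other (suc r) r (λ eq → <⇒≢ (n<1+n r) (sym eq)))
              (trans (proj₁ F₁ (m<n+m (suc r) {2} z<s)) (proj₁ (proj₂ C)))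
      , trans (update-other (2 + r) r (λ eq → <⇒≢ (m<n+m r {2} z<s) (sym eq)))
              (trans (proj₁ F₁ (n<1+n _)) (proj₂ (proj₂ C))))
    , trans (update-same r)
        (trans (cong₂ _+_ (trans (proj₁ F₁ (m<n+m r {3} z<s)) v≡) u≡) (sym (sumTo-suc f v)))
    , frame-trans F (frame-trans (frame-≤ (m≤n+m r 3) F₁) (frame-assign υ _ ≤-refl))

-- The answers are first stored behind the adjacency matrix, which is still
-- needed, and copied to the cells 0, …, n - 1 afterwards.
solve : Term 1 → Cmd
solve e =
  for 1 skip ⨾
  for 3 (compile (3 ∷ []) 5 e ⨾ store (reg 2 ⊕ reg 3) (reg 5)) ⨾
  for 3 (store (reg 3) (load (reg 2 ⊕ reg 3)))

solveTime : Term 1 → ℕ → ℕ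
solveTime e n = forTime n 1 + (forTime n (time e n + 5) + forTime n 6)

-- The address of the entry is `toℕ (combine i j)`, and `remQuot` inverts `combine`.
HasMatrix-input : ∀ {n} (G : Graph n) → HasMatrix G (input G)
HasMatrix-input {n} G i j with n * toℕ i + toℕ j <? n * n
... | yes p = cong (λ ij → bit (uncurry (adj G) ij))
  (trans (cong (remQuot n)
    (trans (fromℕ<-cong _ _ (sym (toℕ-combine i j)) p (toℕ<n (combine i j))) (fromℕ<-toℕ (combine i j) _)))
    (remQuot-combine i j))
... | no ¬p = contradiction (subst (_< n * n) (toℕ-combine i j) (toℕ<n (combine i j))) ¬p

solve-⇓ : ∀ {n} (e : Term 1) (G : Graph n) →
          Runs (solve e) (input G) (solveTime e n) (λ τ → ∀ v → mem τ (toℕ v) ≡ value G e (v ∷ []))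
solve-⇓ {n} e G =
    -- The empty loop is run only for its row offset: after n rounds register 2 holds `n * n`.
    let σ₁ , run₁ , (size₁ , _ , square₁) , _ , mem₁ = for-⇓ {b = 1} {c = skip} (λ _ → Frame 0 (input G)) z<s
         (λ v → stable λ τ y z (_ , m≡) → (λ ()) , m≡)
         (λ v σ C F → σ , ⇓skip , C , F) (input G) refl frame-refl
        σ₂ , run₂ , (size₂ , _ , _) , (square₂ , _ , stored) = for-⇓ P₂ z<s P₂-stable body₂ σ₁ size₁
         (square₁ , (λ i j → trans (cong (λ h → h _) mem₁) (HasMatrix-input G i j)) , λ u ())
        σ₃ , run₃ , _ , (_ , copied , _) = for-⇓ P₃ z<s P₃-stable body₃ σ₂ size₂ (square₂ , (λ u ()) , stored)
    in σ₃ , ⇓seq run₁ (⇓seq run₂ run₃) , λ v → copied v (toℕ<n v)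
  where
  ans : Fin n → ℕ
  ans v = value G e (v ∷ [])

  P₂ : ℕ → State → Set
  P₂ v τ = regs τ 2 ≡ n * n × HasMatrix G τ ×
           (∀ (u : Fin n) → toℕ u < v → mem τ (n * n + toℕ u) ≡ ans u)

  P₂-stable : ∀ v → Stable 3 (P₂ v)
  P₂-stable v = stable λ τ y z Q → Q

  body₂ : ∀ v τ → Counter n 3 (toℕ v) τ → P₂ (toℕ v) τ →
          Runs (compile (3 ∷ []) 5 e ⨾ store (reg 2 ⊕ reg 3) (reg 5)) τ (time e n + 5)
               (λ υ → Counter n 3 (toℕ v) υ × P₂ (suc (toℕ v)) υ)
  body₂ v τ C@(n≡ , v≡ , w≡) (sq , M , S)
    with υ , run , a≡ , F , m≡ ← compile-⇓ (3 ∷ []) 5 e (v ∷ []) τ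
           (record { positive = z<s ; matrix = M ; size = n≡ ; bounded = λ { zero → ≤-refl }
                   ; counters = λ { zero → C } })
    = ⟪ regs υ , mem υ [ regs υ 2 + regs υ 3 ↦ regs υ 5 ] ⟫ , ⇓seq run ⇓store
    , (trans (F z<s) n≡ , trans (F (m<n+m 3 {2} z<s)) v≡ , trans (F ≤-refl) w≡)
    , trans (F (s≤s (s≤s (s≤s z≤n)))) sq
    , (λ i j → trans (update-other (n * toℕ i + toℕ j) (regs υ 2 + regs υ 3)
                       (λ eq → <⇒≢ (matrix<square i j) (trans eq addr)))
                     (trans (cong (λ h → h _) m≡) (M i j)))
    , new
    where
    addr : regs υ 2 + regs υ 3 ≡ n * n + toℕ v
    addr = cong₂ _+_ (trans (F (s≤s (s≤s (s≤s z≤n)))) sq) (trans (F (m<n+m 3 {2} z<s)) v≡)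

    matrix<square : ∀ (i j : Fin n) → n * toℕ i + toℕ j < n * n + toℕ v
    matrix<square i j = <-≤-trans (subst (_< n * n) (toℕ-combine i j) (toℕ<n (combine i j))) (m≤m+n _ _)

    new : ∀ u → toℕ u < suc (toℕ v) → (mem υ [ regs υ 2 + regs υ 3 ↦ regs υ 5 ]) (n * n + toℕ u) ≡ ans u
    new u u≤v with u ≟ v
    ... | yes refl =
      trans (cong (mem υ [ regs υ 2 + regs υ 3 ↦ regs υ 5 ]) (sym addr))
            (trans (update-same (regs υ 2 + regs υ 3)) a≡)
    ... | no u≢v =
      trans (update-other (n * n + toℕ u) (regs υ 2 + regs υ 3)
               (λ eq → u≢v (toℕ-injective (+-cancelˡ-≡ (n * n) _ _ (trans eq addr)))))
            (trans (cong (λ h → h _) m≡) (S u (≤∧≢⇒< (≤-pred u≤v) (u≢v ∘ toℕ-injective))))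

  -- Copying overwrites the matrix, so this invariant keeps only the answers stored behind it.
  P₃ : ℕ → State → Set
  P₃ v τ = regs τ 2 ≡ n * n × (∀ (u : Fin n) → toℕ u < v → mem τ (toℕ u) ≡ ans u) ×
           (∀ (u : Fin n) → toℕ u < n → mem τ (n * n + toℕ u) ≡ ans u)

  P₃-stable : ∀ v → Stable 3 (P₃ v)
  P₃-stable v = stable λ τ y z Q → Q

  body₃ : ∀ v τ → Counter n 3 (toℕ v) τ → P₃ (toℕ v) τ →
          Runs (store (reg 3) (load (reg 2 ⊕ reg 3))) τ 6
               (λ υ → Counter n 3 (toℕ v) υ × P₃ (suc (toℕ v)) υ)
  body₃ v τ C@(n≡ , v≡ , w≡) (sq , A , S) =
    _ , ⇓store , C , sq , new ,
    (λ u u<n → trans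
      (update-other (n * n + toℕ u) (regs τ 3) λ eq → <⇒≢ (below u) (sym (trans eq v≡))) (S u u<n))
    where
    -- As v < n ≤ n * n, a copy never hits an answer that is still to be read.
    below : ∀ u → toℕ v < n * n + toℕ u
    below u = <-≤-trans
      (<-≤-trans (toℕ<n v) (m≤m*n n n ⦃ >-nonZero (≤-<-trans z≤n (toℕ<n v)) ⦄)) (m≤m+n _ _)

    new : ∀ u → toℕ u < suc (toℕ v) →
          (mem τ [ regs τ 3 ↦ mem τ (regs τ 2 + regs τ 3) ]) (toℕ u) ≡ ans u
    new u u≤v with u ≟ v
    ... | yes refl =
      trans (cong (mem τ [ regs τ 3 ↦ mem τ (regs τ 2 + regs τ 3) ]) (sym v≡))
            (trans (update-same (regs τ 3)) (trans (cong (mem τ) (cong₂ _+_ sq v≡)) (S u (toℕ<n u))))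
    ... | no u≢v =
      trans (update-other (toℕ u) (regs τ 3) (λ eq → u≢v (toℕ-injective (trans eq v≡))))
            (A u (≤∧≢⇒< (≤-pred u≤v) (u≢v ∘ toℕ-injective)))

-- Polynomial bounds on running times

Polynomial : (ℕ → ℕ) → Set
Polynomial f = ∃[ a ] ∃[ k ] ∀ n → f n ≤ a * suc n ^ k

poly-const : ∀ c → Polynomial (λ _ → c)
poly-const c = c , 0 , λ n → ≤-reflexive (sym (*-identityʳ c))

-- Both exponents are raised to `k + l`. This is monotone because the base `suc n` is positive even
-- for n = 0.
poly-+ : ∀ {f g} → Polynomial f → Polynomial g → Polynomial (λ n → f n + g n)
poly-+ {f} {g} (a , k , f≤) (b , l , g≤) = a + b , k + l , λ n → begin
  f n + g n                                 ≤⟨ +-mono-≤ (f≤ n) (g≤ n) ⟩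
  a * suc n ^ k + b * suc n ^ l             ≤⟨ +-mono-≤ (*-monoʳ-≤ a (^-monoʳ-≤ (suc n) (m≤m+n k l)))
                                                        (*-monoʳ-≤ b (^-monoʳ-≤ (suc n) (m≤n+m l k))) ⟩
  a * suc n ^ (k + l) + b * suc n ^ (k + l) ≡⟨ *-distribʳ-+ (suc n ^ (k + l)) a b ⟨
  (a + b) * suc n ^ (k + l)                 ∎
  where open ≤-Reasoning

-- Each of the m rounds costs b + 12, and the final test costs at most as much.
loopTime-≤ : ∀ m b → loopTime m b ≤ suc m * (b + 12)
loopTime-≤ zero    b = ≤-trans (m≤n+m 4 (b + 8))
  (≤-reflexive (solve-ℕ 1 (λ b → b :+ con 8 :+ con 4 := b :+ con 12 :+ con 0) refl b))
loopTime-≤ (suc m) b = begin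
  4 + ((b + 8) + loopTime m b)       ≤⟨ +-monoʳ-≤ 4 (+-monoʳ-≤ (b + 8) (loopTime-≤ m b)) ⟩
  4 + ((b + 8) + suc m * (b + 12))   ≡⟨ solve-ℕ 2 (λ b x → con 4 :+ ((b :+ con 8) :+ x) := (b :+ con 12) :+ x) refl
                                               b (suc m * (b + 12)) ⟩
  suc (suc m) * (b + 12)             ∎
  where open ≤-Reasoning

poly-for : ∀ {f} → Polynomial f → Polynomial (λ n → forTime n (f n))
poly-for {f} F = poly-+ (poly-const 4) (a , suc k , λ n → begin
  loopTime n (f n)          ≤⟨ loopTime-≤ n (f n) ⟩
  suc n * (f n + 12)        ≤⟨ *-monoʳ-≤ (suc n) (bound n) ⟩
  suc n * (a * suc n ^ k)   ≡⟨ solve-ℕ 3 (λ x a y → x :* (a :* y) := a :* (x :* y)) refl (suc n) a (suc n ^ k) ⟩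
  a * suc n ^ suc k         ∎)
  where
  open ≤-Reasoning
  F+12 : Polynomial (λ n → f n + 12)
  F+12 = poly-+ F (poly-const 12)
  a k : ℕ
  a = proj₁ F+12
  k = proj₁ (proj₂ F+12)
  bound : ∀ n → f n + 12 ≤ a * suc n ^ k
  bound = proj₂ (proj₂ F+12)

poly-time : ∀ {k} (e : Term k) → Polynomial (time e)
poly-time (num c)    = poly-const 2
poly-time (var i)    = poly-const 2
poly-time (edge i j) = poly-const 5
poly-time (d ⊞ e)    = poly-+ (poly-time d) (poly-+ (poly-time e) (poly-const 4))
poly-time (d ⊟ e)    = poly-+ (poly-time d) (poly-+ (poly-time e) (poly-const 4))
poly-time (∑ e)      = poly-+ (poly-const 2) (poly-for (poly-+ (poly-time e) (poly-const 4)))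

poly-solve : ∀ e → Polynomial (solveTime e)
poly-solve e = poly-+ (poly-for (poly-const 1))
  (poly-+ (poly-for (poly-+ (poly-time e) (poly-const 5))) (poly-for (poly-const 6)))

^-distribʳ-* : ∀ k m n → (m * n) ^ k ≡ m ^ k * n ^ k
^-distribʳ-* zero    m n = refl
^-distribʳ-* (suc k) m n = trans (cong (m * n *_) (^-distribʳ-* k m n))
  (solve-ℕ 4 (λ m n x y → m :* n :* (x :* y) := m :* x :* (n :* y)) refl m n (m ^ k) (n ^ k))

-- For n ≥ 1 the base `suc n` is at most 2n, which costs a factor `2 ^ k`; for n = 0 the additive
-- constant suffices.
poly-bound : ∀ {f} → Polynomial f → ∃[ a ] ∃[ k ] ∀ n → f n ≤ a * n ^ k + a
poly-bound {f} (a , k , f≤) = a * 2 ^ k , k , λ n → ≤-trans (f≤ n) (shift n)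
  where
  open ≤-Reasoning
  suc≤double : ∀ {m} → 2+ m ≤ 2 * suc m
  suc≤double {m} = s≤s (≤-trans (≤-reflexive (+-comm 1 m)) (+-monoʳ-≤ m (s≤s z≤n)))

  shift : ∀ n → a * suc n ^ k ≤ a * 2 ^ k * n ^ k + a * 2 ^ k
  shift zero = begin
    a * 1 ^ k                           ≤⟨ *-monoʳ-≤ a (^-monoˡ-≤ k (s≤s z≤n)) ⟩
    a * 2 ^ k                           ≤⟨ m≤n+m _ _ ⟩
    a * 2 ^ k * 0 ^ k + a * 2 ^ k       ∎
  shift n@(suc m) = begin
    a * suc n ^ k                       ≤⟨ *-monoʳ-≤ a (^-monoˡ-≤ k suc≤double) ⟩
    a * (2 * n) ^ k                     ≡⟨ cong (a *_) (^-distribʳ-* k 2 n) ⟩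
    a * (2 ^ k * n ^ k)                 ≡⟨ *-assoc a (2 ^ k) (n ^ k) ⟨
    a * 2 ^ k * n ^ k                   ≤⟨ m≤m+n _ _ ⟩
    a * 2 ^ k * n ^ k + a * 2 ^ k       ∎

-- Minimal dominating sets of 2K₂-free graphs

∈-tabulate : ∀ {n} (f : Fin n → Bool) {v} → v ∈ tabulate f ⇔ f v ≡ true
∈-tabulate f {v} = mk⇔
  (λ v∈ → trans (sym (lookup∘tabulate f v)) ([]=⇒lookup v∈))
  (λ fv → lookup⇒[]= v (tabulate f) (trans (lookup∘tabulate f v) fv))

∈-does : ∀ {n} {P : Fin n → Set} (P? : ∀ v → Dec (P v)) {v} → v ∈ tabulate (λ v → does (P? v)) ⇔ P v
∈-does P? {v} = mk⇔ (sound ∘ to (∈-tabulate f)) (from (∈-tabulate f) ∘ dec-true (P? v))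
  where
  f : _ → Bool
  f w = does (P? w)

  sound : does (P? v) ≡ true → _
  sound eq with yes p ← P? v = p

-- Induction on D: the image of an element is removed from S before the remaining elements are
-- mapped.
∣∣-injection : ∀ {m n} (D : Subset m) (S : Subset n) (g : Fin m → Fin n) →
               (∀ x → x ∈ D → g x ∈ S) →
               (∀ x y → x ∈ D → y ∈ D → g x ≡ g y → x ≡ y) → ∣ D ∣ ≤ ∣ S ∣
∣∣-injection []            S g into inj = z≤n
∣∣-injection (outside ∷ D) S g into inj =
  ∣∣-injection D S (g ∘ suc) (λ x x∈ → into (suc x) (there x∈))
    (λ x y x∈ y∈ eq → suc-injective (inj (suc x) (suc y) (there x∈) (there y∈) eq))
∣∣-injection (inside ∷ D)  S g into inj =
  ≤-trans (s≤s (∣∣-injection D (S - g zero) (g ∘ suc)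
    (λ x x∈ → x∈p∧x≢y⇒x∈p-y (into (suc x) (there x∈))
      λ eq → contradiction (inj (suc x) zero (there x∈) here eq) λ ())
    (λ x y x∈ y∈ eq → suc-injective (inj (suc x) (suc y) (there x∈) (there y∈) eq))))
  (p⊂q⇒∣p∣<∣q∣ (x∈p⇒p-x⊂p (into zero here)))

-- Greedy improvement under a bounded potential `f`. It serves below for every choice of an extremal
-- object.
ascend : ∀ {A : Set} {P Q : A → Set} (f : A → ℕ) N → (∀ x → P x → f x ≤ N) →
         (∀ x → P x → Q x ⊎ ∃[ y ] P y × f x < f y) →
         ∀ x → P x → ∃[ y ] P y × Q y
ascend {P = P} {Q} f N bound step x p = go (suc N) x p (m≤n+m (suc N) (f x))
  where
  -- The fuel `k` exceeds the distance from `f x` to the bound, so it cannot run out.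
  go : ∀ k x → P x → N < f x + k → ∃[ y ] P y × Q y
  go zero    x p N< = contradiction
    (<-≤-trans N< (≤-trans (≤-reflexive (+-identityʳ _)) (bound x p))) (<-irrefl refl)
  go (suc k) x p N< with step x p
  ... | inj₁ q             = x , p , q
  ... | inj₂ (y , py , lt) =
    go k y py (<-≤-trans N< (≤-trans (≤-reflexive (+-suc (f x) k)) (+-monoˡ-≤ k lt)))

module _ {n} (G : Graph n) where

  infix 4 _~_ _~?_

  _~_ : Fin n → Fin n → Set
  u ~ v = Adj G u v

  _~?_ : ∀ u v → Dec (u ~ v)
  u ~? v = adj G u v Bool.≟ true

  ~-sym : ∀ {u v} → u ~ v → v ~ u
  ~-sym {u} {v} = trans (adj-sym G v u)

  ~⇒≢ : ∀ {u v} → u ~ v → u ≢ v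
  ~⇒≢ {u} u~u refl with () ← trans (sym u~u) (adj-irrefl G u)

  -- Membership of w in the closed neighbourhood N[a].
  Touches : Fin n → Fin n → Set
  Touches w a = w ≡ a ⊎ w ~ a

  Untouched : Fin n → Fin n → Fin n → Fin n → Set
  Untouched a b c w = ¬ Touches w a × ¬ Touches w b × ¬ Touches w c

  -- The case c ≡ b describes the maximal independent sets, for a suitable
  -- edge ab; the case c ≢ b describes the minimal dominating sets D for which
  -- the non-isolated vertices of G[D] are among a, b, c.
  Candidate : Fin n → Fin n → Fin n → Fin n → Set
  Candidate a b c t =
    (c ≡ b × ¬ t ~ b × (∀ w → Untouched a b c w → ¬ t ~ w)) ⊎
    (c ≢ b × ((t ≡ a ⊎ t ≡ b ⊎ t ≡ c) ⊎ Untouched a b c t))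

  -- The private neighbours of x: if M is dominating, the two conditions force v to be x or a
  -- neighbour of x.
  Private : (Fin n → Set) → Fin n → Fin n → Set
  Private M x v = (M v → v ≡ x) × (∀ u → M u → u ≢ x → ¬ v ~ u)

  -- Minimality with quantifiers over vertices instead of vertex sets, hence expressible by a
  -- formula.
  Irredundant : (Fin n → Set) → Set
  Irredundant M = (∀ v → ¬ M v → ∃[ u ] M u × v ~ u) × (∀ x → M x → ∃[ v ] Private M x v)

  dominated? : ∀ D v → Dec (v ∉ D → ∃[ u ] u ∈ D × v ~ u)
  dominated? D v = ¬? (v ∈? D) →-dec any? λ u → (u ∈? D) ×-dec (v ~? u)

  -- A vertex that `D - x` fails to dominate is private to x.
  minimal⇒private : ∀ {D} → MinimalDominating G D → ∀ x → x ∈ D → ∃[ v ] Private (_∈ D) x v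
  minimal⇒private {D} (dom , minimal) x x∈D
    with v , undominated ← ¬∀⟶∃¬ n _ (dominated? (D - x)) (minimal (D - x) (x∈p⇒p-x⊂p x∈D))
    = v , only-x , no-other
    where
    v∉D-x : v ∉ D - x
    v∉D-x v∈ = undominated λ v∉ → contradiction v∈ v∉

    only-x : v ∈ D → v ≡ x
    only-x v∈D with v ≟ x
    ... | yes eq = eq
    ... | no  ne = contradiction (x∈p∧x≢y⇒x∈p-y v∈D ne) v∉D-x

    no-other : ∀ u → u ∈ D → u ≢ x → ¬ v ~ u
    no-other u u∈D u≢x v~u = undominated λ _ → u , x∈p∧x≢y⇒x∈p-y u∈D u≢x , v~u

  -- For the converse, a proper subset that misses x does not dominate a private neighbour of x.
  minimal⇔irredundant : ∀ {D} {M : Fin n → Set} → (∀ {v} → v ∈ D ⇔ M v) →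
                        MinimalDominating G D ⇔ Irredundant M
  minimal⇔irredundant {D} {M} D⇔M = mk⇔
    (λ { min@(dom , _) →
      (λ v ¬Mv → let u , u∈ , v~u = dom v (¬Mv ∘ to D⇔M) in u , to D⇔M u∈ , v~u) ,
      (λ x Mx → let v , only , none = minimal⇒private min x (from D⇔M Mx) in
                v , only ∘ from D⇔M , λ u Mu → none u (from D⇔M Mu)) })
    (λ { (dom , priv) →
      (λ v v∉ → let u , Mu , v~u = dom v (v∉ ∘ from D⇔M) in u , from D⇔M Mu , v~u) ,
      (λ { D′ (D′⊆D , x , x∈D , x∉D′) dom′ → smaller priv D′⊆D x∈D x∉D′ dom′ }) })
    where
    smaller : ∀ {D′ x} → (∀ x → M x → ∃[ v ] Private M x v) → D′ ⊆ D → x ∈ D → x ∉ D′ →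
              ¬ Dominating G D′
    smaller {D′} {x} priv D′⊆D x∈D x∉D′ dom′ with priv x (to D⇔M x∈D)
    ... | v , only , none with v ∈? D′
    ...   | yes v∈ = x∉D′ (subst (_∈ D′) (only (to D⇔M (D′⊆D v∈))) v∈)
    ...   | no  v∉ with u , u∈ , v~u ← dom′ v v∉ =
      none u (to D⇔M (D′⊆D u∈)) (λ { refl → x∉D′ u∈ }) v~u

  Independent : Subset n → Set
  Independent S = ∀ u v → u ∈ S → v ∈ S → ¬ u ~ v

  -- A proper subset that misses x leaves x undominated, since x has no neighbour in S.
  independent-dominating⇒minimal : ∀ {S} → Independent S → Dominating G S → MinimalDominating G S
  independent-dominating⇒minimal {S} ind dom = dom , λ { D′ (D′⊆S , x , x∈S , x∉D′) dom′ →
    let u , u∈ , x~u = dom′ x x∉D′ in ind x u x∈S (D′⊆S u∈) x~u }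

  -- An undominated vertex can be added without creating an edge, until none is left.
  extend-independent : ∀ {S} → Independent S →
    ∃[ T ] (Independent T × ∣ S ∣ ≤ ∣ T ∣) × Dominating G T
  extend-independent {S} ind =
    ascend ∣_∣ n (λ T _ → ∣p∣≤n T) grow S (ind , ≤-refl)
    where
    grow : ∀ T → Independent T × ∣ S ∣ ≤ ∣ T ∣ →
           Dominating G T ⊎ ∃[ T′ ] (Independent T′ × ∣ S ∣ ≤ ∣ T′ ∣) × ∣ T ∣ < ∣ T′ ∣
    grow T (ind , S≤T) with all? (dominated? T)
    ... | yes dom = inj₁ dom
    ... | no ¬dom with v , free ← ¬∀⟶∃¬ n _ (dominated? T) ¬dom =
      inj₂ (T ∪ ⁅ v ⁆ , (ind′ , ≤-trans S≤T (≤-trans (m≤n+m _ 1) bigger)) , bigger)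
      where
      -- The domination condition is vacuous for elements of T, so a vertex violating it lies
      -- outside T.
      bigger : ∣ T ∣ < ∣ T ∪ ⁅ v ⁆ ∣
      bigger = p⊂q⇒∣p∣<∣q∣
        (p⊆p∪q ⁅ v ⁆ , v , q⊆p∪q T ⁅ v ⁆ (x∈⁅x⁆ v) , λ v∈ → free λ v∉ → contradiction v∈ v∉)

      ¬v~ : ∀ {u} → u ∈ T → ¬ v ~ u
      ¬v~ u∈ v~u = free λ _ → _ , u∈ , v~u

      ind′ : Independent (T ∪ ⁅ v ⁆)
      ind′ x y x∈ y∈ x~y with x∈p∪q⁻ T ⁅ v ⁆ x∈ | x∈p∪q⁻ T ⁅ v ⁆ y∈
      ... | inj₁ x∈T | inj₁ y∈T = ind x y x∈T y∈T x~y
      ... | inj₁ x∈T | inj₂ y≡v with refl ← x∈⁅y⁆⇒x≡y v y≡v = ¬v~ x∈T (~-sym x~y)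
      ... | inj₂ x≡v | inj₁ y∈T with refl ← x∈⁅y⁆⇒x≡y v x≡v = ¬v~ y∈T x~y
      ... | inj₂ x≡v | inj₂ y≡v with refl ← x∈⁅y⁆⇒x≡y v x≡v | refl ← x∈⁅y⁆⇒x≡y v y≡v = ~⇒≢ x~y refl

  minimal-dominating-exists : ∃[ D ] MinimalDominating G D
  minimal-dominating-exists =
    let S , (ind , _) , dom = extend-independent {⊥} (λ u v u∈ → contradiction u∈ ∉⊥)
    in S , independent-dominating⇒minimal ind dom

  -- Members of a clique are pairwise distinct, so deleting u shortens the list by at most one. The
  -- clause over all `P` expresses that L is contained in K.
  avoid : ∀ u K → AllPairs _~_ K → ∃[ L ] AllPairs _~_ L × All (_≢ u) L ×
          (∀ {P : Fin n → Set} → All P K → All P L) × length K ≤ suc (length L)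
  avoid u []      []       = [] , [] , [] , id , z≤n
  avoid u (x ∷ K) (x~ ∷ cK) with x ≟ u
  ... | yes refl = K , cK , All.map (λ u~y → ~⇒≢ u~y ∘ sym) x~ , (λ { (_ ∷ ps) → ps }) , ≤-refl
  ... | no  x≢u  =
    let L , cL , L≢ , sub , len = avoid u K cK
    in x ∷ L , sub x~ ∷ cL , x≢u ∷ L≢ , (λ { (p ∷ ps) → p ∷ sub ps }) , s≤s len

  -- Consequences of 2K₂-freeness

  module _ (free : 2K₂-Free G) where

    -- The non-adjacencies make the two edges disjoint: a = c, for instance, would give a ~ d.
    no-2K₂ : ∀ {a b c d} → a ~ b → c ~ d → ¬ a ~ c → ¬ a ~ d → ¬ b ~ c → ¬ b ~ d → Empty
    no-2K₂ {a} {b} {c} {d} a~b c~d a≁c a≁d b≁c b≁d = free (f , f-injective _ _ , f-adj)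
      where
      f : Fin 4 → Fin n
      f = lookup (a ∷ b ∷ c ∷ d ∷ [])

      a≢c : a ≢ c
      a≢c refl = a≁d c~d
      a≢d : a ≢ d
      a≢d refl = a≁c (~-sym c~d)
      b≢c : b ≢ c
      b≢c refl = b≁d c~d
      b≢d : b ≢ d
      b≢d refl = b≁c (~-sym c~d)

      f-injective : ∀ i j → f i ≡ f j → i ≡ j
      f-injective 0F 0F _  = refl
      f-injective 0F 1F eq = contradiction eq (~⇒≢ a~b)
      f-injective 0F 2F eq = contradiction eq a≢c
      f-injective 0F 3F eq = contradiction eq a≢d
      f-injective 1F 0F eq = contradiction (sym eq) (~⇒≢ a~b)
      f-injective 1F 1F _  = refl
      f-injective 1F 2F eq = contradiction eq b≢c
      f-injective 1F 3F eq = contradiction eq b≢d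
      f-injective 2F 0F eq = contradiction (sym eq) a≢c
      f-injective 2F 1F eq = contradiction (sym eq) b≢c
      f-injective 2F 2F _  = refl
      f-injective 2F 3F eq = contradiction eq (~⇒≢ c~d)
      f-injective 3F 0F eq = contradiction (sym eq) a≢d
      f-injective 3F 1F eq = contradiction (sym eq) b≢d
      f-injective 3F 2F eq = contradiction (sym eq) (~⇒≢ c~d)
      f-injective 3F 3F _  = refl

      non : ∀ {u v} → ¬ u ~ v → adj G u v ≡ false
      non {u} {v} u≁v with adj G u v
      ... | true  = contradiction refl u≁v
      ... | false = refl

      f-adj : ∀ i j → adj G (f i) (f j) ≡ adj 2K₂ i j
      f-adj 0F 0F = adj-irrefl G a
      f-adj 0F 1F = a~b
      f-adj 0F 2F = non a≁c
      f-adj 0F 3F = non a≁d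
      f-adj 1F 0F = ~-sym a~b
      f-adj 1F 1F = adj-irrefl G b
      f-adj 1F 2F = non b≁c
      f-adj 1F 3F = non b≁d
      f-adj 2F 0F = non (a≁c ∘ ~-sym)
      f-adj 2F 1F = non (b≁c ∘ ~-sym)
      f-adj 2F 2F = adj-irrefl G c
      f-adj 2F 3F = c~d
      f-adj 3F 0F = non (a≁d ∘ ~-sym)
      f-adj 3F 1F = non (b≁d ∘ ~-sym)
      f-adj 3F 2F = ~-sym c~d
      f-adj 3F 3F = adj-irrefl G d

    maximal-independent⇒candidate : Fin n → ∀ {S} → Independent S → Dominating G S →
      ∃[ a ] ∃[ b ] ∃[ c ] (∀ {t} → t ∈ S ⇔ Candidate a b c t)
    maximal-independent⇒candidate v₀ {S} ind dom with any? (λ u → ¬? (u ∈? S))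
    -- Here S contains all vertices, so G has no edges and any triple with equal entries will do.
    ... | no all∈ = v₀ , v₀ , v₀ , λ {t} → mk⇔
      (λ t∈ → inj₁ (refl , ind t v₀ t∈ (in-S v₀) , λ w _ → ind t w t∈ (in-S w)))
      (λ _ → in-S t)
      where
      in-S : ∀ v → v ∈ S
      in-S v = decidable-stable (v ∈? S) λ v∉ → all∈ (v , v∉)
    ... | yes (u₀ , u₀∉S) =
      -- `ascend` maximises, so the potential is the size of the complement of N(u) ∩ S.
      let u , u∉S , minimal = ascend {P = _∉ S} {Q = Minimal} (λ u → ∣ ∁ (N u) ∣) n
                                (λ u _ → ∣p∣≤n (∁ (N u))) shrink u₀ u₀∉S
          s , s∈S , u~s     = dom u u∉S
      in u , s , s , mk⇔ (forth u∉S minimal s∈S u~s) (back u∉S minimal s∈S u~s)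
      where
      N : Fin n → Subset n
      N u = S ∩ tabulate (adj G u)

      N⁻ : ∀ {u t} → t ∈ N u → t ∈ S × u ~ t
      N⁻ {u} t∈ = let t∈S , u~t = x∈p∩q⁻ S (tabulate (adj G u)) t∈ in t∈S , to (∈-tabulate (adj G u)) u~t

      N⁺ : ∀ {u t} → t ∈ S → u ~ t → t ∈ N u
      N⁺ t∈S u~t = x∈p∩q⁺ (t∈S , from (∈-tabulate (adj G _)) u~t)

      Minimal : Fin n → Set
      Minimal u = ∀ {w s} → w ∉ S → N w ⊆ N u → s ∈ N u → s ∈ N w

      shrink : ∀ u → u ∉ S → Minimal u ⊎ ∃[ w ] w ∉ S × ∣ ∁ (N u) ∣ < ∣ ∁ (N w) ∣
      shrink u u∉S with any? (λ w → ¬? (w ∈? S) ×-dec (N w ⊂? N u))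
      ... | yes (w , w∉S , Nw⊂Nu) = inj₂ (w , w∉S , p⊂q⇒∣p∣<∣q∣ (p⊂q⇒∁p⊃∁q Nw⊂Nu))
      ... | no none = inj₁ λ {w} {s} w∉S Nw⊆Nu s∈Nu →
        decidable-stable (s ∈? N w) λ s∉Nw → none (w , w∉S , Nw⊆Nu , s , s∈Nu , s∉Nw)

      module _ {u s} (u∉S : u ∉ S) (minimal : Minimal u) (s∈S : s ∈ S) (u~s : u ~ s) where

        -- By minimality of u, such a w has the same neighbours in S as u, and s is one of them.
        touches-s : ∀ {w} → w ∉ S → (∀ {t} → t ∈ S → w ~ t → u ~ t) → w ~ s
        touches-s w∉S sub = proj₂ (N⁻ (minimal w∉S
          (λ t∈Nw → let t∈S , w~t = N⁻ t∈Nw in N⁺ t∈S (sub t∈S w~t)) (N⁺ s∈S u~s)))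

        -- If w were outside S, each of its neighbours t in S would be adjacent to u, as otherwise
        -- us and wt would induce a 2K₂; then w ~ s.
        untouched∈S : ∀ w → Untouched u s s w → w ∈ S
        untouched∈S w (¬u , ¬s , _) = decidable-stable (w ∈? S) λ w∉S →
          ¬s (inj₂ (touches-s w∉S λ {t} t∈S w~t → decidable-stable (u ~? t) λ u≁t →
            no-2K₂ u~s w~t (¬u ∘ inj₂ ∘ ~-sym) u≁t (¬s ∘ inj₂ ∘ ~-sym) (ind s t s∈S t∈S)))

        forth : ∀ {t} → t ∈ S → Candidate u s s t
        forth {t} t∈S = inj₁ (refl , ind t s t∈S s∈S , λ w Uw → ind t w t∈S (untouched∈S w Uw))

        back : ∀ {t} → Candidate u s s t → t ∈ S
        back (inj₂ (s≢s , _)) = contradiction refl s≢s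
        back {t} (inj₁ (_ , t≁s , ¬U)) = decidable-stable (t ∈? S) λ t∉S →
          -- A neighbour r of t in S that is not adjacent to u would be untouched by u and s,
          -- against the choice of t.
          t≁s (touches-s t∉S λ {r} r∈S t~r → decidable-stable (u ~? r) λ u≁r →
            ¬U r ( [ (λ { refl → u∉S r∈S }) , u≁r ∘ ~-sym ]
                 , [ (λ { refl → u≁r u~s }) , ind r s r∈S s∈S ]
                 , [ (λ { refl → u≁r u~s }) , ind r s r∈S s∈S ] ) t~r)

    module _ {D} (D-min : MinimalDominating G D) where

      Linked : Fin n → Set
      Linked x = x ∈ D × ∃[ y ] y ∈ D × x ~ y

      linked? : ∀ x → Dec (Linked x)
      linked? x = (x ∈? D) ×-dec any? λ y → (y ∈? D) ×-dec (x ~? y)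

      record Mate (x q : Fin n) : Set where
        field
          x∈D   : x ∈ D
          q∉D   : q ∉ D
          q~x   : q ~ x
          alone : ∀ {u} → u ∈ D → u ≢ x → ¬ q ~ u
      open Mate

      -- As x has a neighbour in D, it is not its own private neighbour; so the private neighbour
      -- lies outside D, where only x can dominate it.
      mate : ∀ x → Linked x → ∃[ q ] Mate x q
      mate x (x∈D , y , y∈D , x~y) with q , only , none ← minimal⇒private D-min x x∈D =
        q , record { x∈D = x∈D ; q∉D = q∉ ; q~x = q~ ; alone = λ {u} → none u }
        where
        q∉ : q ∉ D
        q∉ q∈ with refl ← only q∈ = none y y∈D (~⇒≢ x~y ∘ sym) x~y

        q~ : q ~ x
        q~ with u , u∈D , q~u ← proj₁ D-min q q∉ | u ≟ x
        ... | yes refl = q~u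
        ... | no  u≢x  = contradiction q~u (none u u∈D u≢x)

      -- Otherwise the edges xp and yq would induce a 2K₂.
      mates-adjacent : ∀ {x y p q} → Mate x p → Mate y q → x ≢ y → ¬ x ~ y → p ~ q
      mates-adjacent {p = p} {q} X Y x≢y x≁y = decidable-stable (p ~? q) λ p≁q →
        no-2K₂ (~-sym (q~x X)) (~-sym (q~x Y)) x≁y (alone Y (x∈D X) x≢y ∘ ~-sym)
               (alone X (x∈D Y) (x≢y ∘ sym)) p≁q

      -- Otherwise the edges xy and pq would induce a 2K₂, as each mate has only its own partner as
      -- a neighbour in D.
      mates-nonadjacent : ∀ {x y z w p q} → x ∈ D → y ∈ D → Mate z p → Mate w q →
        x ≢ z → x ≢ w → y ≢ z → y ≢ w → x ~ y → ¬ p ~ q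
      mates-nonadjacent x∈ y∈ Z W x≢z x≢w y≢z y≢w x~y p~q =
        no-2K₂ x~y p~q (alone Z x∈ x≢z ∘ ~-sym) (alone W x∈ x≢w ∘ ~-sym)
               (alone Z y∈ y≢z ∘ ~-sym) (alone W y∈ y≢w ∘ ~-sym)

      opposite : ∀ {x y z w} → x ∈ D → y ∈ D → Linked z → Linked w →
        x ≢ z → x ≢ w → y ≢ z → y ≢ w → z ≢ w → x ~ y → z ~ w
      opposite {z = z} {w} x∈ y∈ Lz Lw x≢z x≢w y≢z y≢w z≢w x~y =
        decidable-stable (z ~? w) λ z≁w →
          let _ , Z = mate z Lz ; _ , W = mate w Lw
          in mates-nonadjacent x∈ y∈ Z W x≢z x≢w y≢z y≢w x~y (mates-adjacent Z W z≢w z≁w)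

      -- If x and z were not adjacent, then px ~ pz and hence y ≁ w. Either outcome for px and pw
      -- settles enough adjacencies to exhibit an induced 2K₂.
      adjacent : ∀ {x y z w} → Linked x → Linked y → Linked z → Linked w →
        x ≢ z → x ≢ w → y ≢ z → y ≢ w → z ≢ w → x ~ y → x ~ z
      adjacent {x} {y} {z} {w} Lx Ly Lz Lw x≢z x≢w y≢z y≢w z≢w x~y =
        decidable-stable (x ~? z) refute
        where
        px py pz pw : Fin n
        px = proj₁ (mate x Lx)
        py = proj₁ (mate y Ly)
        pz = proj₁ (mate z Lz)
        pw = proj₁ (mate w Lw)
        X : Mate x px
        X = proj₂ (mate x Lx)
        Y : Mate y py
        Y = proj₂ (mate y Ly)
        Z : Mate z pz
        Z = proj₂ (mate z Lz)
        W : Mate w pw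
        W = proj₂ (mate w Lw)

        x≢y : x ≢ y
        x≢y = ~⇒≢ x~y

        z~w : z ~ w
        z~w = opposite (x∈D X) (x∈D Y) Lz Lw x≢z x≢w y≢z y≢w z≢w x~y

        refute : ¬ ¬ x ~ z
        refute x≁z with px ~? pw
        ... | yes px~pw =
          -- Now y ≁ z, so py ~ pz and thus x ≁ w: the 2K₂ lies in D.
          no-2K₂ x~y z~w x≁z x≁w y≁z y≁w
          where
          y≁w : ¬ y ~ w
          y≁w y~w = mates-nonadjacent (x∈D Y) (x∈D W) X Z (x≢y ∘ sym) y≢z (x≢w ∘ sym) (z≢w ∘ sym) y~w
            (mates-adjacent X Z x≢z x≁z)
          y≁z : ¬ y ~ z
          y≁z y~z = mates-nonadjacent (x∈D Y) (x∈D Z) X W (x≢y ∘ sym) y≢w (x≢z ∘ sym) z≢w y~z px~pw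
          x≁w : ¬ x ~ w
          x≁w x~w = mates-nonadjacent (x∈D X) (x∈D W) Y Z x≢y x≢z (y≢w ∘ sym) (z≢w ∘ sym) x~w
            (mates-adjacent Y Z y≢z y≁z)
        ... | no px≁pw =
          -- Now x ~ w, and the 2K₂ lies among the mates, with edges px pz and py pw.
          no-2K₂ px~pz (mates-adjacent Y W y≢w y≁w)
            (mates-nonadjacent (x∈D Z) (x∈D W) X Y (x≢z ∘ sym) (y≢z ∘ sym) (x≢w ∘ sym) (y≢w ∘ sym) z~w)
            px≁pw
            (mates-nonadjacent (x∈D X) (x∈D W) Y Z x≢y x≢z (y≢w ∘ sym) (z≢w ∘ sym) x~w ∘ ~-sym)
            (mates-nonadjacent (x∈D X) (x∈D Y) Z W x≢z x≢w y≢z y≢w x~y)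
          where
          px~pz : px ~ pz
          px~pz = mates-adjacent X Z x≢z x≁z
          y≁w : ¬ y ~ w
          y≁w y~w = mates-nonadjacent (x∈D Y) (x∈D W) X Z (x≢y ∘ sym) y≢z (x≢w ∘ sym) (z≢w ∘ sym) y~w px~pz
          x~w : x ~ w
          x~w = decidable-stable (x ~? w) λ x≁w → px≁pw (mates-adjacent X W x≢w x≁w)

      -- The vertex c may coincide with a, which covers the case of exactly two linked vertices.
      few-linked⇒candidate : ∀ a b c → a ∈ D → b ∈ D → c ∈ D → a ~ b → c ≢ b →
        (∀ x → Linked x → x ≡ a ⊎ x ≡ b ⊎ x ≡ c) → ∀ {t} → t ∈ D ⇔ Candidate a b c t
      few-linked⇒candidate a b c a∈ b∈ c∈ a~b c≢b few {t} = mk⇔ forth back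
        where
        isolated : ∀ {d} → d ∈ D → ¬ (d ≡ a ⊎ d ≡ b ⊎ d ≡ c) → ∀ {e} → e ∈ D → ¬ d ~ e
        isolated d∈ d≢ e∈ d~e = d≢ (few _ (d∈ , _ , e∈ , d~e))

        one-of? : ∀ d → Dec (d ≡ a ⊎ d ≡ b ⊎ d ≡ c)
        one-of? d = (d ≟ a) ⊎-dec (d ≟ b) ⊎-dec (d ≟ c)

        forth : t ∈ D → Candidate a b c t
        forth t∈ with one-of? t
        ... | yes t≡ = inj₂ (c≢b , inj₁ t≡)
        ... | no  t≢ = inj₂ (c≢b , inj₂
          ( [ t≢ ∘ inj₁ , isolated t∈ t≢ a∈ ]
          , [ t≢ ∘ inj₂ ∘ inj₁ , isolated t∈ t≢ b∈ ]
          , [ t≢ ∘ inj₂ ∘ inj₂ , isolated t∈ t≢ c∈ ] ))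

        back : Candidate a b c t → t ∈ D
        back (inj₁ (c≡b , _)) = contradiction c≡b c≢b
        back (inj₂ (_ , inj₁ (inj₁ refl))) = a∈
        back (inj₂ (_ , inj₁ (inj₂ (inj₁ refl)))) = b∈
        back (inj₂ (_ , inj₁ (inj₂ (inj₂ refl)))) = c∈
        -- A vertex d of D dominating t would be isolated in G[D], so td and ab would induce a 2K₂.
        back (inj₂ (_ , inj₂ (¬a , ¬b , ¬c))) = decidable-stable (t ∈? D) λ t∉ →
          let d , d∈ , t~d = proj₁ D-min t t∉
              d≢ : ¬ (d ≡ a ⊎ d ≡ b ⊎ d ≡ c)
              d≢ = λ { (inj₁ refl)        → ¬a (inj₂ t~d)
                     ; (inj₂ (inj₁ refl)) → ¬b (inj₂ t~d)
                     ; (inj₂ (inj₂ refl)) → ¬c (inj₂ t~d) }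
          in no-2K₂ t~d a~b (¬a ∘ inj₂) (¬b ∘ inj₂) (isolated d∈ d≢ a∈) (isolated d∈ d≢ b∈)

      -- The independent set consists of the isolated vertices of G[D] and the
      -- mates of the others.
      many-linked⇒independent : (K : List (Fin n)) → AllPairs _~_ K → All (_∈ D) K → 4 ≤ length K →
        ∃[ S ] Independent S × ∣ D ∣ ≤ ∣ S ∣
      many-linked⇒independent K clique K⊆D 4≤K = S , S-independent , ∣∣-injection D S g g∈S g-injective
        where
        Image : Fin n → Fin n → Set
        Image x y = (y ≡ x × ¬ Linked x) ⊎ Mate x y

        image : ∀ x → ∃[ y ] Image x y
        image x with linked? x
        ... | yes L = let q , Q = mate x L in q , inj₂ Q
        ... | no ¬L = x , inj₁ (refl , ¬L)

        g : Fin n → Fin n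
        g x = proj₁ (image x)

        in-image? : ∀ y → Dec (∃[ x ] x ∈ D × g x ≡ y)
        in-image? y = any? λ x → (x ∈? D) ×-dec (g x ≟ y)

        S : Subset n
        S = tabulate λ y → does (in-image? y)

        g∈S : ∀ x → x ∈ D → g x ∈ S
        g∈S x x∈ = from (∈-does in-image?) (x , x∈ , refl)

        injective : ∀ {x y p q} → x ∈ D → y ∈ D → Image x p → Image y q → p ≡ q → x ≡ y
        injective x∈ y∈ (inj₁ (refl , _)) (inj₁ (refl , _)) eq   = eq
        injective x∈ y∈ (inj₁ (refl , _)) (inj₂ Y)          refl = contradiction x∈ (q∉D Y)
        injective x∈ y∈ (inj₂ X)          (inj₁ (refl , _)) refl = contradiction y∈ (q∉D X)
        injective {x} {y} x∈ y∈ (inj₂ X)  (inj₂ Y)          refl =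
          decidable-stable (x ≟ y) λ x≢y → alone Y x∈ x≢y (q~x X)

        g-injective : ∀ x y → x ∈ D → y ∈ D → g x ≡ g y → x ≡ y
        g-injective x y x∈ y∈ = injective x∈ y∈ (proj₂ (image x)) (proj₂ (image y))

        -- Deleting x and y from a clique of at least four vertices leaves an edge zw of D, which
        -- forces the mates of x and y apart.
        separate : ∀ {x y p q} → Mate x p → Mate y q → ¬ p ~ q
        separate {x} {y} X Y with avoid x K clique
        ... | L , cL , L≢x , sub , len with avoid y L cL
        ... | []         , _ , _ , _ , len′ =
          contradiction (≤-trans 4≤K (≤-trans len (s≤s len′))) λ { (s≤s (s≤s ())) }
        ... | _ ∷ []     , _ , _ , _ , len′ =
          contradiction (≤-trans 4≤K (≤-trans len (s≤s len′))) λ { (s≤s (s≤s (s≤s ()))) }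
        ... | z ∷ w ∷ _  , (z~w ∷ _) ∷ _ , z≢y ∷ w≢y ∷ _ , sub′ , _
          with z∈ ∷ w∈ ∷ _ ← sub′ (sub K⊆D) | z≢x ∷ w≢x ∷ _ ← sub′ L≢x =
          mates-nonadjacent z∈ w∈ X Y z≢x z≢y w≢x w≢y z~w

        nonadjacent : ∀ {x y p q} → x ∈ D → y ∈ D → x ≢ y → Image x p → Image y q → ¬ p ~ q
        nonadjacent x∈ y∈ x≢y (inj₁ (refl , ¬L)) (inj₁ (refl , _)) x~y = ¬L (x∈ , _ , y∈ , x~y)
        nonadjacent x∈ y∈ x≢y (inj₁ (refl , _))  (inj₂ Y)          x~q = alone Y x∈ x≢y (~-sym x~q)
        nonadjacent x∈ y∈ x≢y (inj₂ X)           (inj₁ (refl , _)) p~y = alone X y∈ (x≢y ∘ sym) p~y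
        nonadjacent x∈ y∈ x≢y (inj₂ X)           (inj₂ Y)          p~q = separate X Y p~q

        S-independent : Independent S
        S-independent u v u∈ v∈ u~v
          with x , x∈ , refl ← to (∈-does in-image?) u∈ | y , y∈ , refl ← to (∈-does in-image?) v∈ | x ≟ y
        ... | yes refl = ~⇒≢ u~v refl
        ... | no  x≢y  = nonadjacent x∈ y∈ x≢y (proj₂ (image x)) (proj₂ (image y)) u~v

      Beaten : Set
      Beaten = ∃[ a ] ∃[ b ] ∃[ c ] ∃[ E ] (∀ {t} → t ∈ E ⇔ Candidate a b c t) ×
               MinimalDominating G E × ∣ D ∣ ≤ ∣ E ∣

      independent⇒beaten : Fin n → ∀ {S} → Independent S → ∣ D ∣ ≤ ∣ S ∣ → Beaten
      independent⇒beaten v₀ ind D≤S =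
        let T , (ind′ , S≤T) , dom = extend-independent ind
            a , b , c , T⇔ = maximal-independent⇒candidate v₀ ind′ dom
        in a , b , c , T , T⇔ , independent-dominating⇒minimal ind′ dom , ≤-trans D≤S S≤T

      -- Cases by the number of linked vertices: none, two, three, or at least four. A single one is
      -- impossible, because its neighbour in D is linked too.
      beaten : Fin n → Beaten
      beaten v₀ with any? linked?
      ... | no none = independent⇒beaten v₀ (λ u v u∈ v∈ u~v → none (u , u∈ , v , v∈ , u~v)) ≤-refl
      ... | yes (x , Lx@(x∈ , y , y∈ , x~y))
        with any? (λ z → linked? z ×-dec ¬? (x ≟ z) ×-dec ¬? (y ≟ z))
      ... | no none =
        x , y , x , D , few-linked⇒candidate x y x x∈ y∈ x∈ x~y (~⇒≢ x~y) few , D-min , ≤-refl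
        where
        few : ∀ z → Linked z → z ≡ x ⊎ z ≡ y ⊎ z ≡ x
        few z Lz with x ≟ z | y ≟ z
        ... | yes eq | _      = inj₁ (sym eq)
        ... | no _   | yes eq = inj₂ (inj₁ (sym eq))
        ... | no x≢z | no y≢z = contradiction (z , Lz , x≢z , y≢z) none
      ... | yes (z , Lz@(z∈ , _) , x≢z , y≢z)
        with any? (λ w → linked? w ×-dec ¬? (x ≟ w) ×-dec ¬? (y ≟ w) ×-dec ¬? (z ≟ w))
      ... | no none =
        x , y , z , D , few-linked⇒candidate x y z x∈ y∈ z∈ x~y (y≢z ∘ sym) few , D-min , ≤-refl
        where
        few : ∀ w → Linked w → w ≡ x ⊎ w ≡ y ⊎ w ≡ z
        few w Lw with x ≟ w | y ≟ w | z ≟ w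
        ... | yes eq | _      | _      = inj₁ (sym eq)
        ... | no _   | yes eq | _      = inj₂ (inj₁ (sym eq))
        ... | no _   | no _   | yes eq = inj₂ (inj₂ (sym eq))
        ... | no x≢w | no y≢w | no z≢w = contradiction (w , Lw , x≢w , y≢w , z≢w) none
      ... | yes (w , Lw@(w∈ , _) , x≢w , y≢w , z≢w) =
        let S , ind , D≤S = many-linked⇒independent (x ∷ y ∷ z ∷ w ∷ [])
              ( (x~y ∷ adjacent Lx Ly Lz Lw x≢z x≢w y≢z y≢w z≢w x~y
                     ∷ adjacent Lx Ly Lw Lz x≢w x≢z y≢w y≢z (z≢w ∘ sym) x~y ∷ [])
              ∷ ( adjacent Ly Lx Lz Lw y≢z y≢w x≢z x≢w z≢w (~-sym x~y)
                ∷ adjacent Ly Lx Lw Lz y≢w y≢z x≢w x≢z (z≢w ∘ sym) (~-sym x~y) ∷ [])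
              ∷ (opposite x∈ y∈ Lz Lw x≢z x≢w y≢z y≢w z≢w x~y ∷ []) ∷ [] ∷ [])
              (x∈ ∷ y∈ ∷ z∈ ∷ w∈ ∷ []) ≤-refl
        in independent⇒beaten v₀ ind D≤S
        where
        Ly : Linked y
        Ly = y∈ , x , x∈ , ~-sym x~y

-- Formulas and their translation into terms

infix  7 _∼_ _≈_ _≺_
infixr 6 _∧_
infixr 5 _∨_
infixr 4 _⇒_

data Formula (k : ℕ) : Set where
  _∼_ _≈_ _≺_   : Fin k → Fin k → Formula k
  neg           : Formula k → Formula k
  _∧_ _∨_ _⇒_   : Formula k → Formula k → Formula k
  ex all        : Formula (suc k) → Formula k
  card≤         : Formula (suc k) → Formula (suc k) → Formula k

module _ {n} (G : Graph n) where

  -- The extents compared by `card≤` are finite sets only through the decision procedure, so truth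
  -- and decidability are defined together.
  mutual
    Holds : ∀ {k} → Formula k → Vec (Fin n) k → Set
    Holds (i ∼ j)     ρ = Adj G (lookup ρ i) (lookup ρ j)
    Holds (i ≈ j)     ρ = lookup ρ i ≡ lookup ρ j
    Holds (i ≺ j)     ρ = toℕ (lookup ρ i) < toℕ (lookup ρ j)
    Holds (neg φ)     ρ = ¬ Holds φ ρ
    Holds (φ ∧ ψ)     ρ = Holds φ ρ × Holds ψ ρ
    Holds (φ ∨ ψ)     ρ = Holds φ ρ ⊎ Holds ψ ρ
    Holds (φ ⇒ ψ)     ρ = Holds φ ρ → Holds ψ ρ
    Holds (ex φ)      ρ = ∃[ v ] Holds φ (v ∷ ρ)
    Holds (all φ)     ρ = ∀ v → Holds φ (v ∷ ρ)
    Holds (card≤ φ ψ) ρ = ∣ extent φ ρ ∣ ≤ ∣ extent ψ ρ ∣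

    extent : ∀ {k} → Formula (suc k) → Vec (Fin n) k → Subset n
    extent φ ρ = tabulate λ v → does (holds? φ (v ∷ ρ))

    holds? : ∀ {k} (φ : Formula k) ρ → Dec (Holds φ ρ)
    holds? (i ∼ j)     ρ = adj G (lookup ρ i) (lookup ρ j) Bool.≟ true
    holds? (i ≈ j)     ρ = lookup ρ i ≟ lookup ρ j
    holds? (i ≺ j)     ρ = toℕ (lookup ρ i) <? toℕ (lookup ρ j)
    holds? (neg φ)     ρ = ¬? (holds? φ ρ)
    holds? (φ ∧ ψ)     ρ = holds? φ ρ ×-dec holds? ψ ρ
    holds? (φ ∨ ψ)     ρ = holds? φ ρ ⊎-dec holds? ψ ρ
    holds? (φ ⇒ ψ)     ρ = holds? φ ρ →-dec holds? ψ ρ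
    holds? (ex φ)      ρ = any? λ v → holds? φ (v ∷ ρ)
    holds? (all φ)     ρ = all? λ v → holds? φ (v ∷ ρ)
    holds? (card≤ φ ψ) ρ = ∣ extent φ ρ ∣ ≤? ∣ extent ψ ρ ∣

-- Truth is encoded as positivity, not as the value 1; hence disjunctions and existential
-- quantifiers are plain sums, and truncated subtraction from 1 is negation.
term : ∀ {k} → Formula k → Term k
term (i ∼ j)     = edge i j
term (i ≈ j)     = num 1 ⊟ ((var i ⊟ var j) ⊞ (var j ⊟ var i))
term (i ≺ j)     = var j ⊟ var i
term (neg φ)     = num 1 ⊟ term φ
term (φ ∧ ψ)     = num 1 ⊟ ((num 1 ⊟ term φ) ⊞ (num 1 ⊟ term ψ))
term (φ ∨ ψ)     = term φ ⊞ term ψ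
term (φ ⇒ ψ)     = (num 1 ⊟ term φ) ⊞ term ψ
term (ex φ)      = ∑ (term φ)
term (all φ)     = num 1 ⊟ ∑ (num 1 ⊟ term φ)
term (card≤ φ ψ) =
  num 1 ⊟ (∑ (num 1 ⊟ (num 1 ⊟ term φ)) ⊟ ∑ (num 1 ⊟ (num 1 ⊟ term ψ)))

positive-∸ : ∀ {x y} → 0 < x ∸ y ⇔ y < x
positive-∸ {x} {y} = mk⇔ (λ p → m∸n≢0⇒n<m (λ eq → <⇒≢ p (sym eq))) m<n⇒0<n∸m

positive-neg : ∀ {x} → 0 < 1 ∸ x ⇔ (¬ 0 < x)
positive-neg {zero}  = mk⇔ (λ _ ()) (λ _ → z<s)
positive-neg {suc x} = mk⇔
  (λ p → contradiction (subst (0 <_) (0∸n≡0 x) p) λ ())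
  (λ ¬p → contradiction z<s ¬p)

positive-+ : ∀ {x y} → 0 < x + y ⇔ (0 < x ⊎ 0 < y)
positive-+ {zero}  = mk⇔ inj₂ λ { (inj₁ ()) ; (inj₂ p) → p }
positive-+ {suc x} = mk⇔ (λ _ → inj₁ z<s) (λ _ → z<s)

positive-sum : ∀ {n} (f : Fin n → ℕ) → 0 < sumTo f n ⇔ (∃[ v ] 0 < f v)
positive-sum {zero}  f = mk⇔ (λ ()) λ ()
positive-sum {suc n} f = mk⇔ forth back
  where
  forth : 0 < sumTo f (suc n) → ∃[ v ] 0 < f v
  forth p with to positive-+ p
  ... | inj₁ q = zero , q
  ... | inj₂ q = let v , r = to (positive-sum (λ v → f (suc v))) q in suc v , r

  back : (∃[ v ] 0 < f v) → 0 < sumTo f (suc n)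
  back (zero , q)  = from positive-+ (inj₁ q)
  back (suc v , q) = from (positive-+ {f zero}) (inj₂ (from (positive-sum (λ v → f (suc v))) (v , q)))

-- The double negation `1 ∸ (1 ∸ x)` turns every positive value into 1, so that the sum counts.
sum-indicator : ∀ {n} {P : Fin n → Set} (P? : ∀ v → Dec (P v)) (f : Fin n → ℕ) →
                (∀ v → 0 < f v ⇔ P v) →
                sumTo (λ v → 1 ∸ (1 ∸ f v)) n ≡ ∣ tabulate (λ v → does (P? v)) ∣
sum-indicator {zero}  P? f f⇔ = refl
sum-indicator {suc n} P? f f⇔
  with f zero | f⇔ zero | P? zero | sum-indicator (λ v → P? (suc v)) (λ v → f (suc v)) (λ v → f⇔ (suc v))
... | zero  | _  | no _   | eq = eq
... | zero  | e  | yes p  | eq = contradiction (from e p) λ ()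
... | suc x | e  | no ¬p  | eq = contradiction (to e z<s) ¬p
... | suc x | e  | yes _  | eq rewrite 0∸n≡0 x = cong suc eq

module _ {n} (G : Graph n) where

  term-correct : ∀ {k} (φ : Formula k) ρ → 0 < value G (term φ) ρ ⇔ Holds G φ ρ
  term-correct (i ∼ j) ρ with adj G (lookup ρ i) (lookup ρ j)
  ... | true  = mk⇔ (λ _ → refl) (λ _ → z<s)
  ... | false = mk⇔ (λ ()) λ ()
  term-correct (i ≈ j) ρ = mk⇔
    (λ p → let ¬< = to positive-neg p in toℕ-injective (≤-antisym
       (≮⇒≥ (¬< ∘ from positive-+ ∘ inj₁ ∘ m<n⇒0<n∸m))
       (≮⇒≥ (¬< ∘ from (positive-+ {toℕ (lookup ρ i) ∸ toℕ (lookup ρ j)}) ∘ inj₂ ∘ m<n⇒0<n∸m))))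
    (λ eq → from positive-neg λ p → [ irreflexive eq , irreflexive (sym eq) ] (to positive-+ p))
    where
    irreflexive : ∀ {u v : Fin n} → u ≡ v → ¬ 0 < toℕ u ∸ toℕ v
    irreflexive {u} refl p = <-irrefl refl (to (positive-∸ {toℕ u}) p)
  term-correct (i ≺ j) ρ = positive-∸
  term-correct (neg φ) ρ = ¬-cong-⇔ (term-correct φ ρ) ⇔-∘ positive-neg
  term-correct (φ ∧ ψ) ρ = mk⇔
    (λ ¬p → decidable-stable (holds? G φ ρ) (λ ¬φ →
              ¬p (from positive-+ (inj₁ (from positive-neg (¬φ ∘ to (term-correct φ ρ))))))
          , decidable-stable (holds? G ψ ρ) (λ ¬ψ →
              ¬p (from (positive-+ {1 ∸ value G (term φ) ρ}) (inj₂ (from positive-neg (¬ψ ∘ to (term-correct ψ ρ)))))))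
    (λ { (p , q) r → [ (λ ¬φ → to positive-neg ¬φ (from (term-correct φ ρ) p))
                     , (λ ¬ψ → to positive-neg ¬ψ (from (term-correct ψ ρ) q)) ] (to positive-+ r) })
    ⇔-∘ positive-neg
  term-correct (φ ∨ ψ) ρ = (term-correct φ ρ ⊎-⇔ term-correct ψ ρ) ⇔-∘ positive-+
  term-correct (φ ⇒ ψ) ρ = mk⇔
    (λ { (inj₁ ¬φ) p → contradiction (from (term-correct φ ρ) p) (to positive-neg ¬φ)
       ; (inj₂ q)  _ → to (term-correct ψ ρ) q })
    back
    ⇔-∘ positive-+
    where
    back : (Holds G φ ρ → Holds G ψ ρ) → 0 < 1 ∸ value G (term φ) ρ ⊎ 0 < value G (term ψ) ρ
    back f with holds? G φ ρ
    ... | yes p = inj₂ (from (term-correct ψ ρ) (f p))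
    ... | no ¬p = inj₁ (from positive-neg (¬p ∘ to (term-correct φ ρ)))
  term-correct (ex φ) ρ = mk⇔
    (λ { (v , p) → v , to (term-correct φ (v ∷ ρ)) p })
    (λ { (v , p) → v , from (term-correct φ (v ∷ ρ)) p })
    ⇔-∘ positive-sum _
  term-correct (all φ) ρ = mk⇔
    (λ none v → decidable-stable (holds? G φ (v ∷ ρ)) λ ¬p →
      none (v , from positive-neg (¬p ∘ to (term-correct φ (v ∷ ρ)))))
    (λ { every (v , ¬p) → to positive-neg ¬p (from (term-correct φ (v ∷ ρ)) (every v)) })
    ⇔-∘ (¬-cong-⇔ (positive-sum _) ⇔-∘ positive-neg)
  term-correct (card≤ φ ψ) ρ
    rewrite sum-indicator (λ v → holds? G φ (v ∷ ρ)) (λ v → value G (term φ) (v ∷ ρ))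
                          (λ v → term-correct φ (v ∷ ρ))
          | sum-indicator (λ v → holds? G ψ (v ∷ ρ)) (λ v → value G (term ψ) (v ∷ ρ))
                          (λ v → term-correct ψ (v ∷ ρ))
    = mk⇔ (λ ¬p → ≮⇒≥ (¬p ∘ from positive-∸))
          (λ le p → <-irrefl refl (<-≤-trans (to positive-∸ p) le))
      ⇔-∘ positive-neg

-- The answer as a formula

touches : ∀ {k} → Fin k → Fin k → Formula k
touches w a = w ≈ a ∨ w ∼ a

untouched : ∀ {k} → Fin k → Fin k → Fin k → Fin k → Formula k
untouched a b c w = neg (touches w a) ∧ neg (touches w b) ∧ neg (touches w c)

candidate : ∀ {k} → Fin k → Fin k → Fin k → Fin k → Formula k
candidate a b c t =
  (c ≈ b ∧ neg (t ∼ b) ∧ all (untouched (suc a) (suc b) (suc c) 0F ⇒ neg (suc t ∼ 0F))) ∨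
  (neg (c ≈ b) ∧ ((t ≈ a ∨ t ≈ b ∨ t ≈ c) ∨ untouched a b c t))

irredundant : ∀ {k} → Fin k → Fin k → Fin k → Formula k
irredundant a b c =
  all (neg (M₁ 0F) ⇒ ex (M₂ 0F ∧ 1F ∼ 0F)) ∧
  all (M₁ 0F ⇒ ex ((M₂ 0F ⇒ 0F ≈ 1F) ∧ all (M₃ 0F ⇒ neg (0F ≈ 2F) ⇒ neg (1F ∼ 0F))))
  where
  -- The candidate set below one, two and three quantifiers.
  M₁ = candidate (suc a) (suc b) (suc c)
  M₂ = candidate (suc (suc a)) (suc (suc b)) (suc (suc c))
  M₃ = candidate (suc (suc (suc a))) (suc (suc (suc b))) (suc (suc (suc c)))

best : ∀ {k} → Fin k → Fin k → Fin k → Formula k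
best a b c =
  irredundant a b c ∧
  all (all (all (irredundant 2F 1F 0F ⇒
    card≤ (candidate 3F 2F 1F 0F) (candidate (4+ a) (4+ b) (4+ c) 0F))))
  where
  -- Shifts past the three quantifiers for the competing triple and the vertex bound by `card≤`.
  4+ : ∀ {k} → Fin k → Fin (4 + k)
  4+ v = suc (suc (suc (suc v)))

-- Projecting away the last coordinates lets the lexicographically first triple be found one
-- coordinate at a time.
best₂ : ∀ {k} → Fin k → Fin k → Formula k
best₂ a b = ex (best (suc a) (suc b) 0F)

best₁ : ∀ {k} → Fin k → Formula k
best₁ a = ex (best₂ (suc a) 0F)

-- t lies in the candidate of the lexicographically first best triple.
answer : Formula 1
answer =
  ex ((best₁ 0F ∧ all (0F ≺ 1F ⇒ neg (best₁ 0F))) ∧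
  ex ((best₂ 1F 0F ∧ all (0F ≺ 1F ⇒ neg (best₂ 2F 0F))) ∧
  ex ((best 2F 1F 0F ∧ all (0F ≺ 1F ⇒ neg (best 3F 2F 0F))) ∧
  candidate 2F 1F 0F 3F)))

-- The first best triple

record Least {n} (P : Fin n → Set) (x : Fin n) : Set where
  constructor least
  field
    holds : P x
    first : ∀ y → toℕ y < toℕ x → ¬ P y

least-exists : ∀ {n} {P : Fin n → Set} → (∀ v → Dec (P v)) → ∃[ v ] P v → ∃[ v ] Least P v
least-exists {n} {P} P? (v , Pv) =
  -- The potential `n ∸ toℕ x` turns the descent into an ascent.
  let x , Px , x-first = ascend (λ x → n ∸ toℕ x) n (λ x _ → m∸n≤m n (toℕ x)) descend v Pv
  in x , least Px x-first
  where
  descend : ∀ x → P x → (∀ y → toℕ y < toℕ x → ¬ P y) ⊎ ∃[ y ] P y × n ∸ toℕ x < n ∸ toℕ y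
  descend x Px with any? (λ y → (toℕ y <? toℕ x) ×-dec P? y)
  ... | yes (y , y<x , Py) = inj₂ (y , Py , ∸-monoʳ-< y<x (<⇒≤ (toℕ<n x)))
  ... | no none            = inj₁ λ y y<x Py → none (y , y<x , Py)

least-unique : ∀ {n} {P : Fin n → Set} {x y} → Least P x → Least P y → x ≡ y
least-unique {x = x} {y} (least Px x-least) (least Py y-least) with <-cmp (toℕ x) (toℕ y)
... | tri< x<y _ _ = contradiction Px (y-least x x<y)
... | tri≈ _ x≡y _ = toℕ-injective x≡y
... | tri> _ _ y<x = contradiction Py (x-least y y<x)

least-⇔ : ∀ {n} (P : Fin n → Set) {A : Set} {B : Fin n → Set} {x} → A ⇔ P x → (∀ y → B y ⇔ P y) →
          (A × (∀ y → toℕ y < toℕ x → ¬ B y)) ⇔ Least P x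
least-⇔ P A⇔ B⇔ = mk⇔ (λ (h , l) → least (to A⇔ h) λ y y<x → l y y<x ∘ from (B⇔ y))
                      (λ (least h l) → from A⇔ h , λ y y<x → l y y<x ∘ to (B⇔ y))

module _ {n} (G : Graph n) where

  candidates : Fin n → Fin n → Fin n → Subset n
  candidates a b c = extent G (candidate 1F 2F 3F 0F) (a ∷ b ∷ c ∷ [])

  ∈-candidates : ∀ a b c {t} → t ∈ candidates a b c ⇔ Candidate G a b c t
  ∈-candidates a b c = ∈-does λ t → holds? G (candidate 1F 2F 3F 0F) (t ∷ a ∷ b ∷ c ∷ [])

  Minimal : Fin n × Fin n × Fin n → Set
  Minimal (a , b , c) = Irredundant G (Candidate G a b c)

  opaque
    minimal? : ∀ abc → Dec (Minimal abc)
    minimal? (a , b , c) = holds? G (irredundant 0F 1F 2F) (a ∷ b ∷ c ∷ [])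

  record Best (a b c : Fin n) : Set where
    field
      minimal : Minimal (a , b , c)
      maximum : ∀ a′ b′ c′ → Minimal (a′ , b′ , c′) → ∣ candidates a′ b′ c′ ∣ ≤ ∣ candidates a b c ∣

  Best₂ : Fin n → Fin n → Set
  Best₂ a b = ∃[ c ] Best a b c

  Best₁ : Fin n → Set
  Best₁ a = ∃[ b ] Best₂ a b

  -- The semantics of the formula unfolds to exactly the two fields of `Best`.
  best-⇔ : ∀ {k} (a b c : Fin k) ρ → Holds G (best a b c) ρ ⇔ Best (lookup ρ a) (lookup ρ b) (lookup ρ c)
  best-⇔ a b c ρ = mk⇔ (λ (m , x) → record { minimal = m ; maximum = x })
                       (λ B → Best.minimal B , Best.maximum B)

  best₂-⇔ : ∀ {k} (a b : Fin k) ρ → Holds G (best₂ a b) ρ ⇔ Best₂ (lookup ρ a) (lookup ρ b)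
  best₂-⇔ a b ρ = mk⇔ (λ (c , h) → c , to (best-⇔ (suc a) (suc b) 0F (c ∷ ρ)) h)
                      (λ (c , B) → c , from (best-⇔ (suc a) (suc b) 0F (c ∷ ρ)) B)

  best₁-⇔ : ∀ {k} (a : Fin k) ρ → Holds G (best₁ a) ρ ⇔ Best₁ (lookup ρ a)
  best₁-⇔ a ρ = mk⇔ (λ (b , h) → b , to (best₂-⇔ (suc a) 0F (b ∷ ρ)) h)
                    (λ (b , B) → b , from (best₂-⇔ (suc a) 0F (b ∷ ρ)) B)

  opaque
    best? : ∀ a b c → Dec (Best a b c)
    best? a b c = Dec.map (best-⇔ 0F 1F 2F ρ) (holds? G (best 0F 1F 2F) ρ)
      where
      ρ : Vec (Fin n) 3
      ρ = a ∷ b ∷ c ∷ []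

  best₂? : ∀ a b → Dec (Best₂ a b)
  best₂? a b = any? (best? a b)

  best₁? : ∀ a → Dec (Best₁ a)
  best₁? a = any? (best₂? a)

  best-exists : ∃[ abc ] Minimal abc → ∃[ a ] ∃[ b ] ∃[ c ] Best a b c
  best-exists (abc , m) =
    let (a , b , c) , m′ , max = ascend {Q = Maximum} order n
          (λ (a , b , c) _ → ∣p∣≤n (candidates a b c)) improve abc m
    in a , b , c , record { minimal = m′ ; maximum = max }
    where
    order : Fin n × Fin n × Fin n → ℕ
    order (a , b , c) = ∣ candidates a b c ∣

    Maximum : Fin n × Fin n × Fin n → Set
    Maximum abc = ∀ a′ b′ c′ → Minimal (a′ , b′ , c′) → order (a′ , b′ , c′) ≤ order abc

    improve : ∀ abc → Minimal abc → Maximum abc ⊎ ∃[ abc′ ] Minimal abc′ × order abc < order abc′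
    improve abc m with any? (λ a′ → any? (λ b′ → any? (λ c′ →
      minimal? (a′ , b′ , c′) ×-dec (order abc <? order (a′ , b′ , c′)))))
    ... | yes (a′ , b′ , c′ , m′ , lt) = inj₂ ((a′ , b′ , c′) , m′ , lt)
    ... | no none = inj₁ λ a′ b′ c′ m′ → ≮⇒≥ λ lt → none (a′ , b′ , c′ , m′ , lt)

  -- Membership is evaluated separately for each t, so ties between best triples must be broken in
  -- the same way for all t.
  First : Fin n → Set
  First t =
    ∃[ a ] Least Best₁ a × ∃[ b ] Least (Best₂ a) b × ∃[ c ] Least (Best a b) c × Candidate G a b c t

  answer-⇔ : ∀ {t} → Holds G answer (t ∷ []) ⇔ First t
  answer-⇔ {t} = mk⇔
    (λ (a , La , b , Lb , c , Lc , t∈) →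
      a , to (least₁ a) La , b , to (least₂ a b) Lb , c , to (least₃ a b c) Lc , t∈)
    (λ (a , La , b , Lb , c , Lc , t∈) →
      a , from (least₁ a) La , b , from (least₂ a b) Lb , c , from (least₃ a b c) Lc , t∈)
    where
    least₁ = λ a → least-⇔ Best₁ (best₁-⇔ 0F (a ∷ t ∷ [])) (λ x → best₁-⇔ 0F (x ∷ a ∷ t ∷ []))
    least₂ = λ a b → least-⇔ (Best₂ a) (best₂-⇔ 1F 0F (b ∷ a ∷ t ∷ []))
                       (λ x → best₂-⇔ 2F 0F (x ∷ b ∷ a ∷ t ∷ []))
    least₃ = λ a b c → least-⇔ (Best a b) (best-⇔ 2F 1F 0F (c ∷ b ∷ a ∷ t ∷ []))
                         (λ x → best-⇔ 3F 2F 0F (x ∷ c ∷ b ∷ a ∷ t ∷ []))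

  first-unique : ∀ {a b c a′ b′ c′} → Least Best₁ a → Least (Best₂ a) b → Least (Best a b) c →
                 Least Best₁ a′ → Least (Best₂ a′) b′ → Least (Best a′ b′) c′ →
                 (a , b , c) ≡ (a′ , b′ , c′)
  first-unique La Lb Lc La′ Lb′ Lc′
    with refl ← least-unique La La′
    with refl ← least-unique Lb Lb′
    with refl ← least-unique Lc Lc′ = refl

  first-⇔ : ∀ {a b c} → Least Best₁ a → Least (Best₂ a) b → Least (Best a b) c → ∀ {t} →
            First t ⇔ Candidate G a b c t
  first-⇔ La Lb Lc {t} = mk⇔
    (λ (a′ , La′ , b′ , Lb′ , c′ , Lc′ , t∈) →
      subst (λ (a , b , c) → Candidate G a b c t) (sym (first-unique La Lb Lc La′ Lb′ Lc′)) t∈)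
    (λ t∈ → _ , La , _ , Lb , _ , Lc , t∈)

  first-best : ∃[ abc ] Minimal abc →
               ∃[ a ] ∃[ b ] ∃[ c ] Best a b c × (∀ {t} → First t ⇔ Candidate G a b c t)
  first-best m
    with a₀ , b₀ , c₀ , B₀ ← best-exists m
    -- The least `a` comes with its own completion `b₁`, `c₁`, which shows that a least `b` exists;
    -- likewise for `c`.
    with a , La@(least (b₁ , c₁ , B₁) _) ← least-exists {P = Best₁} best₁? (a₀ , b₀ , c₀ , B₀)
    with b , Lb@(least (c₂ , B₂) _) ← least-exists {P = Best₂ a} (best₂? a) (b₁ , c₁ , B₁)
    with c , Lc@(least B _) ← least-exists {P = Best a b} (best? a b) (c₂ , B₂)
    = a , b , c , B , first-⇔ La Lb Lc

  candidates-unique : ∀ {a b c E} → (∀ {t} → t ∈ E ⇔ Candidate G a b c t) → E ≡ candidates a b c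
  candidates-unique {a} {b} {c} E⇔ = ⊆-antisym
    (λ t∈ → from (∈-candidates a b c) (to E⇔ t∈)) (λ t∈ → from E⇔ (to (∈-candidates a b c) t∈))

  -- By `beaten`, every minimal dominating set is at most as large as some candidate that is itself
  -- minimal dominating, hence at most as large as the best one. Applied to any minimal dominating
  -- set, `beaten` also shows that such a candidate exists.
  first-upper : 2K₂-Free G → Fin n → ∀ {S} → (∀ {t} → t ∈ S ⇔ First t) → UpperDominating G S
  first-upper free v₀ {S} S⇔ =
    let D₀ , min₀ = minimal-dominating-exists G
        a₀ , b₀ , c₀ , E₀ , E₀⇔ , E₀-min , _ = beaten G free min₀ v₀
        a , b , c , B , F⇔ = first-best ((a₀ , b₀ , c₀) , to (minimal⇔irredundant G E₀⇔) E₀-min)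
    in upper B (mk⇔ (to F⇔ ∘ to S⇔) (from S⇔ ∘ from F⇔))
    where
    maximum : ∀ {a b c} → Best a b c → (∀ {t} → t ∈ S ⇔ Candidate G a b c t) →
              ∀ D → MinimalDominating G D → ∣ D ∣ ≤ ∣ S ∣
    maximum B S⇔C D D-min =
      let a′ , b′ , c′ , E , E⇔ , E-min , D≤E = beaten G free D-min v₀
      in ≤-trans D≤E (subst₂ _≤_
           (sym (cong ∣_∣ (candidates-unique E⇔))) (sym (cong ∣_∣ (candidates-unique S⇔C)))
           (Best.maximum B a′ b′ c′ (to (minimal⇔irredundant G E⇔) E-min)))

    upper : ∀ {a b c} → Best a b c → (∀ {t} → t ∈ S ⇔ Candidate G a b c t) → UpperDominating G S
    upper B S⇔C = from (minimal⇔irredundant G S⇔C) (Best.minimal B) , maximum B S⇔C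

theorem5p4 : ComputableInPolynomialTime 2K₂-Free UpperDominating
theorem5p4 = solve e , a , k , λ {n} G free →
  let σ , run , correct = solve-⇓ e G
  in σ , solveTime e n , run , proj₂ (proj₂ bound) n , upper G free σ correct
  where
  e : Term 1
  e = term answer

  bound : ∃[ a ] ∃[ k ] ∀ n → solveTime e n ≤ a * n ^ k + a
  bound = poly-bound (poly-solve e)

  a k : ℕ
  a = proj₁ bound
  k = proj₁ (proj₂ bound)

  upper : ∀ {n} (G : Graph n) → 2K₂-Free G → ∀ σ → (∀ v → mem σ (toℕ v) ≡ value G e (v ∷ [])) →
          UpperDominating G (output n σ)
  -- Without vertices there is no default vertex `v₀`, and the empty set is the only vertex set.
  upper {zero}  G free σ correct = ((λ ()) , λ { [] (_ , () , _) }) , λ { [] _ → z≤n }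
  upper {suc n} G free σ correct = first-upper G free zero λ {t} →
    mk⇔ (λ t∈ → to (answer-⇔ G) (to (term-correct G answer (t ∷ [])) (subst (0 <_) (correct t)
                  (<ᵇ⇒< 0 _ (Bool.T-≡ .from (to (∈-tabulate member) t∈))))))
        (λ p → from (∈-tabulate member) (Bool.T-≡ .to (<⇒<ᵇ (subst (0 <_) (sym (correct t))
                  (from (term-correct G answer (t ∷ [])) (from (answer-⇔ G) p))))))
    where
    member : Fin (suc n) → Bool
    member v = 0 <ᵇ mem σ (toℕ v)
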